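{- Let $n$ be a positive integer and let $D$ be a loopless multigraph on the vertex set of the complete graph $K_n$ with maximum degree $\Delta(D)\le 2\lfloor\frac{n}{6}\rfloor-4$. Then $D$ is realizable in $K_n$.
   Context: Given a simple graph $G$ and a multigraph $D$ (the demand graph) with $V(D)=V(G)$, $D$ is realizable in $G$ if there exist pairwise edge-disjoint paths $P_1,\dots,P_{|E(D)|}$ in $G$ such that $P_i$ joins the two endpoints of the $i$-th edge $e_i$ of $D$, for every $i$ (parallel edges of $D$ count separately). -}

module Defs where

open import Data.Nat using (ℕ; zero; suc; _+_)
open import Data.Fin using (Fin)
open import Data.List using (List; []; _∷_; length; lookup; filter)
open import Data.List.Relation.Unary.AllPairs using (AllPairs)
open import Data.List.Relation.Unary.Unique.Propositional using (Unique)
open import Data.List.Membership.Propositional using (_∈_)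
open import Data.Product using (_×_; _,_; proj₁; proj₂; Σ)
open import Data.Sum using (_⊎_)
open import Relation.Binary.PropositionalEquality using (_≡_)
open import Relation.Nullary using (¬_)
open import Relation.Nullary.Decidable using (_⊎-dec_)
open import Data.Fin.Properties using (_≟_)
open import Data.Empty using (⊥)

-- A demand multigraph on vertex set Fin n: a list of edges (pairs of
-- endpoints); repeated entries are parallel edges.
DemandGraph : ℕ → Set
DemandGraph n = List (Fin n × Fin n)

Loopless : ∀ {n} → DemandGraph n → Set
Loopless {n} D = ∀ (e : Fin n × Fin n) → e ∈ D → ¬ (proj₁ e ≡ proj₂ e)

-- degree of v in D: number of edges of D incident with v
-- (D is loopless in the theorem, so each incident edge counts once)
degree : ∀ {n} → DemandGraph n → Fin n → ℕ
degree D v = length (filter (λ e → (proj₁ e ≟ v) ⊎-dec (proj₂ e ≟ v)) D)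

MaxDegree≤ : ∀ {n} → DemandGraph n → ℕ → Set
MaxDegree≤ {n} D k = ∀ (v : Fin n) → degree D v Data.Nat.≤ k

-- Walks in the complete graph K_n from u to v, as vertex sequences where
-- consecutive vertices are distinct (i.e. adjacent in K_n).
data Walk {n : ℕ} : Fin n → Fin n → Set where
  [_]  : (u : Fin n) → Walk u u
  _∷⟨_⟩_ : (u : Fin n) {w v : Fin n} → ¬ (u ≡ w) → Walk w v → Walk u v

vertices : ∀ {n} {u v : Fin n} → Walk u v → List (Fin n)
vertices [ u ] = u ∷ []
vertices (u ∷⟨ _ ⟩ p) = u ∷ vertices p

IsPath : ∀ {n} {u v : Fin n} → Walk u v → Set
IsPath p = Unique (vertices p)

Path : ∀ {n} → Fin n → Fin n → Set
Path u v = Σ (Walk u v) IsPath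

data UsesEdge {n : ℕ} (a b : Fin n) : {u v : Fin n} → Walk u v → Set where
  here  : ∀ {w v} {ne : ¬ (a ≡ w)} {p : Walk w v} → w ≡ b → UsesEdge a b (a ∷⟨ ne ⟩ p)
  here' : ∀ {w v} {ne : ¬ (b ≡ w)} {p : Walk w v} → w ≡ a → UsesEdge a b (b ∷⟨ ne ⟩ p)
  there : ∀ {u w v} {ne : ¬ (u ≡ w)} {p : Walk w v} → UsesEdge a b p → UsesEdge a b (u ∷⟨ ne ⟩ p)

EdgeDisjoint : ∀ {n} {u v u' v' : Fin n} → Walk u v → Walk u' v' → Set
EdgeDisjoint {n} p q = ∀ (a b : Fin n) → UsesEdge a b p → UsesEdge a b q → ⊥

RealizableInComplete : ∀ {n} → DemandGraph n → Set
RealizableInComplete {n} D =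
  Σ ((i : Fin (length D)) → Path (proj₁ (lookup D i)) (proj₂ (lookup D i))) λ P →
    ∀ (i j : Fin (length D)) → ¬ (i ≡ j) → EdgeDisjoint (proj₁ (P i)) (proj₁ (P j))

{-# OPTIONS --safe #-}
module Submission where

-- Idea: remove six vertices at a time while lowering the maximum degree 2k by two.
-- A balanced orientation followed by König's theorem splits the demands into k partial
-- permutations. Two of them are coloured properly with three colours each, so that every colour is
-- missing at about a third of the vertices, and each of these six colours is given a centre. A
-- demand of colour j is routed through the centre of colour j, which frees a vertex from its four
-- demands of the two permutations and leaves two of its edges to the centres unused. Demands that
-- remain at the centre of colour j are handed over along these unused edges to different vertices
-- missing colour j, so that every vertex receives at most two of them.

open import Defs
open import Data.Bool using (Bool; true; false; not; if_then_else_)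
import Data.Bool.Properties as Bool
open import Data.Empty using (⊥)
open import Data.Fin using (Fin; zero; suc; _↑ˡ_; _↑ʳ_; splitAt; toℕ)
open import Data.Fin.Patterns using (0F; 1F; 2F)
open import Data.Fin.Properties
  using (_≟_; any?; all?; ¬∀⟶∃¬; suc-injective; toℕ<n; toℕ-injective; ↑ˡ-injective; ↑ʳ-injective; splitAt-↑ˡ; splitAt-↑ʳ)
open import Data.List using (List; []; _∷_; length; lookup; filter)
open import Data.List.Membership.Propositional using (_∈_)
import Data.List.Membership.DecPropositional as DecMembership
open import Data.List.Relation.Unary.All.Properties using (¬Any⇒All¬)
open import Data.List.Relation.Unary.AllPairs using ([]; _∷_)
open import Data.List.Relation.Unary.All using ([]; _∷_)
open import Data.List.Relation.Unary.Any using (here; there)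
open import Data.Maybe using (Maybe; just; nothing)
import Data.Maybe.Properties as Maybe
open import Data.Nat using (ℕ; zero; suc; _+_; _*_; _/_; _≤_; _<_; z≤n; s≤s; s≤s⁻¹)
open import Data.Nat.DivMod using (m/n*n≤m)
import Data.Nat.Properties as ℕ
open import Data.Nat.Properties hiding (_≟_; suc-injective)
open import Data.Nat.Solver using (module +-*-Solver)
open import Data.Product using (Σ; _×_; _,_; proj₁; proj₂; ∃; ∃-syntax; map₂)
open import Data.Product.Properties using (≡-dec)
open import Data.Sum using (_⊎_; inj₁; inj₂; [_,_]′)
open import Data.Unit using (⊤; tt)
open import Data.Vec.Functional using () renaming (_∷_ to infixr 5 _◂_)
open import Function using (_∘_; id)
open import Level using (0ℓ)
open import Relation.Binary using (DecidableEquality)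
open import Relation.Binary.Construct.Closure.ReflexiveTransitive
  using (Star; ε; _◅_; _◅◅_; reverse; return) renaming (map to Star-map)
open import Relation.Binary.PropositionalEquality
open import Relation.Nullary using (¬_; Dec; does; yes; no; _because_; contradiction)
open import Relation.Nullary.Decidable using (_×-dec_; _⊎-dec_; _→-dec_; ¬?; from-yes)
open import Relation.Unary using (Pred; Decidable)

open import Algebra.Properties.Semiring.Sum +-*-semiring
  using (sum; sum-cong-≗; ∑-distrib-+; ∑-comm; *-distribˡ-sum; *-distribʳ-sum; sum-replicate-zero)

-- Counting in finite sets

-- The obstacle is that centres carry demands themselves, so an edge between two centres could be
-- wanted from both sides. Within one factor this is prevented by taking the centre of colour j
-- among the vertices that miss the colour after j. Between the two factors it is prevented by not
-- moving the halves of a factor that lie at centres of the other factor. Holding halves back has a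
-- price: some demands that would have been finished stay alive at a centre, and the centres
-- themselves are lost as receivers. For a fixed colour, each centre of the other factor causes at
-- most one of these losses, never both. When the maximum degree is 2(k + 2), a centre must pass on
-- 2k halves of untouched demands and at most 2 of the other factor; one more unit is lost to a
-- centre of its own factor and three to those of the other factor. So each colour has to be missing
-- at 2k + 6 vertices. The three-colouring guarantees a third of the vertices minus 2, hence 6(k +
-- 2) + 12 vertices suffice. This 12, two blocks of six, is the source of the 4 in the degree bound.

𝟙 : {P : Set} → Dec P → ℕ
𝟙 (true because _)  = 1
𝟙 (false because _) = 0

𝟙≤1 : {P : Set} (p? : Dec P) → 𝟙 p? ≤ 1
𝟙≤1 (yes _) = s≤s z≤n
𝟙≤1 (no _)  = z≤n

𝟙-yes : {P : Set} (p? : Dec P) → P → 𝟙 p? ≡ 1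
𝟙-yes (yes _) _ = refl
𝟙-yes (no ¬p) p = contradiction p ¬p

𝟙-no : {P : Set} (p? : Dec P) → ¬ P → 𝟙 p? ≡ 0
𝟙-no (yes p) ¬p = contradiction p ¬p
𝟙-no (no _)  _  = refl

𝟙-mono : {P Q : Set} (p? : Dec P) (q? : Dec Q) → (P → Q) → 𝟙 p? ≤ 𝟙 q?
𝟙-mono (yes p) q? f = ≤-reflexive (sym (𝟙-yes q? (f p)))
𝟙-mono (no _)  q? f = z≤n

𝟙-cong : {P Q : Set} (p? : Dec P) (q? : Dec Q) → (P → Q) → (Q → P) → 𝟙 p? ≡ 𝟙 q?
𝟙-cong p? q? f g = ≤-antisym (𝟙-mono p? q? f) (𝟙-mono q? p? g)

𝟙-× : {P Q : Set} (p? : Dec P) (q? : Dec Q) → 𝟙 (p? ×-dec q?) ≡ 𝟙 p? * 𝟙 q?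
𝟙-× (yes _) (yes _) = refl
𝟙-× (yes _) (no _)  = refl
𝟙-× (no _)  _       = refl

sum-mono : ∀ {n} {f g : Fin n → ℕ} → (∀ i → f i ≤ g i) → sum f ≤ sum g
sum-mono {zero}  f≤g = z≤n
sum-mono {suc n} f≤g = +-mono-≤ (f≤g zero) (sum-mono (f≤g ∘ suc))

sum-≤-const : ∀ {n} {f : Fin n → ℕ} c → (∀ i → f i ≤ c) → sum f ≤ n * c
sum-≤-const {zero}  c f≤c = z≤n
sum-≤-const {suc n} c f≤c = +-mono-≤ (f≤c zero) (sum-≤-const c (f≤c ∘ suc))

n≤sum : ∀ {n} {f : Fin n → ℕ} → (∀ i → 1 ≤ f i) → n ≤ sum f
n≤sum {zero}  1≤f = z≤n
n≤sum {suc n} 1≤f = +-mono-≤ (1≤f zero) (n≤sum (1≤f ∘ suc))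

term≤sum : ∀ {n} (f : Fin n → ℕ) i → f i ≤ sum f
term≤sum f zero    = m≤m+n _ _
term≤sum f (suc i) = ≤-trans (term≤sum (f ∘ suc) i) (m≤n+m _ _)

sum-zero : ∀ {n} {f : Fin n → ℕ} → (∀ i → f i ≡ 0) → sum f ≡ 0
sum-zero {n} f≡0 = trans (sum-cong-≗ f≡0) (sum-replicate-zero n)

-- The change at the single index i is written crosswise, so that no truncated subtraction occurs.
sum-replace : ∀ {n} (f g : Fin n → ℕ) i → (∀ j → j ≢ i → f j ≡ g j) →
              sum f + g i ≡ sum g + f i
sum-replace f g zero eq = begin
  f zero + sum (f ∘ suc) + g zero ≡⟨ cong (λ s → f zero + s + g zero) (sum-cong-≗ (λ j → eq (suc j) (λ ()))) ⟩
  f zero + sum (g ∘ suc) + g zero ≡⟨ +-comm (f zero + sum (g ∘ suc)) (g zero) ⟩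
  g zero + (f zero + sum (g ∘ suc)) ≡⟨ cong (g zero +_) (+-comm (f zero) _) ⟩
  g zero + (sum (g ∘ suc) + f zero) ≡⟨ +-assoc (g zero) _ _ ⟨
  g zero + sum (g ∘ suc) + f zero ∎
  where open ≡-Reasoning
sum-replace f g (suc i) eq = begin
  f zero + sum (f ∘ suc) + g (suc i)   ≡⟨ +-assoc (f zero) _ _ ⟩
  f zero + (sum (f ∘ suc) + g (suc i)) ≡⟨ cong₂ _+_ (eq zero (λ ()))
                                            (sum-replace (f ∘ suc) (g ∘ suc) i (λ j j≢i → eq (suc j) (j≢i ∘ suc-injective))) ⟩
  g zero + (sum (g ∘ suc) + f (suc i)) ≡⟨ +-assoc (g zero) _ _ ⟨
  g zero + sum (g ∘ suc) + f (suc i)   ∎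
  where open ≡-Reasoning

count : ∀ {n} {P : Pred (Fin n) 0ℓ} → Decidable P → ℕ
count P? = sum (λ i → 𝟙 (P? i))

module _ {n} {P Q : Pred (Fin n) 0ℓ} (P? : Decidable P) (Q? : Decidable Q) where

  count-mono : (∀ {i} → P i → Q i) → count P? ≤ count Q?
  count-mono P⊆Q = sum-mono (λ i → 𝟙-mono (P? i) (Q? i) P⊆Q)

  count-cong : (∀ {i} → P i → Q i) → (∀ {i} → Q i → P i) → count P? ≡ count Q?
  count-cong P⊆Q Q⊆P = sum-cong-≗ (λ i → 𝟙-cong (P? i) (Q? i) P⊆Q Q⊆P)

  count-split : count P? ≡ count (λ i → P? i ×-dec Q? i) + count (λ i → P? i ×-dec ¬? (Q? i))
  count-split = trans (sum-cong-≗ (λ i → split (P? i) (Q? i)))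
                      (∑-distrib-+ (λ i → 𝟙 (P? i ×-dec Q? i)) (λ i → 𝟙 (P? i ×-dec ¬? (Q? i))))
    where
    split : {A B : Set} (a? : Dec A) (b? : Dec B) → 𝟙 a? ≡ 𝟙 (a? ×-dec b?) + 𝟙 (a? ×-dec ¬? b?)
    split (yes _) (yes _) = refl
    split (yes _) (no _)  = refl
    split (no _)  _       = refl

count-cover : ∀ {n} {P Q R : Pred (Fin n) 0ℓ} (P? : Decidable P) (Q? : Decidable Q) (R? : Decidable R) →
              (∀ {i} → P i → Q i ⊎ R i) → count P? ≤ count Q? + count R?
count-cover P? Q? R? P⊆Q∪R =
  ≤-trans (sum-mono (λ i → cover (P? i) (Q? i) (R? i) P⊆Q∪R))
          (≤-reflexive (∑-distrib-+ (λ i → 𝟙 (Q? i)) (λ i → 𝟙 (R? i))))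
  where
  cover : {A B C : Set} (a? : Dec A) (b? : Dec B) (c? : Dec C) → (A → B ⊎ C) → 𝟙 a? ≤ 𝟙 b? + 𝟙 c?
  cover (no _)  b? c? f = z≤n
  cover (yes a) b? c? f with f a
  ... | inj₁ b = ≤-trans (≤-reflexive (sym (𝟙-yes b? b))) (m≤m+n _ _)
  ... | inj₂ c = ≤-trans (≤-reflexive (sym (𝟙-yes c? c))) (m≤n+m _ _)

module _ {n} {P : Pred (Fin n) 0ℓ} (P? : Decidable P) where

  count-pos : ∀ {i} → P i → 1 ≤ count P?
  count-pos {i} p = ≤-trans (≤-reflexive (sym (𝟙-yes (P? i) p))) (term≤sum (λ i → 𝟙 (P? i)) i)

  count-none : (∀ {i} → ¬ P i) → count P? ≡ 0
  count-none ¬P = sum-zero (λ i → 𝟙-no (P? i) ¬P)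

  count-witness : 1 ≤ count P? → ∃ P
  count-witness 1≤c with any? P?
  ... | yes ∃P = ∃P
  ... | no ¬∃P = contradiction (subst (1 ≤_) (count-none (λ p → ¬∃P (_ , p))) 1≤c) λ ()

  count-remove : ∀ {i} → P i → count P? ≡ suc (count (λ j → P? j ×-dec ¬? (j ≟ i)))
  count-remove {i} p = begin
    count P?                              ≡⟨ +-identityʳ _ ⟨
    count P? + 0                          ≡⟨ cong (count P? +_) (𝟙-no (P′? i) (λ q → proj₂ q refl)) ⟨
    count P? + 𝟙 (P′? i)                  ≡⟨ sum-replace _ _ i (λ j j≢i → 𝟙-cong (P? j) (P′? j) (_, j≢i) proj₁) ⟩
    count P′? + 𝟙 (P? i)                  ≡⟨ cong (count P′? +_) (𝟙-yes (P? i) p) ⟩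
    count P′? + 1                         ≡⟨ +-comm _ 1 ⟩
    suc (count P′?)                       ∎
    where
    open ≡-Reasoning
    P′? = λ j → P? j ×-dec ¬? (j ≟ i)

  count≤1⇒unique : count P? ≤ 1 → ∀ {i j} → P i → P j → i ≡ j
  count≤1⇒unique c≤1 {i} {j} p q with j ≟ i
  ... | yes j≡i = sym j≡i
  ... | no  j≢i = contradiction (≤-trans (s≤s (sum-pos)) (≤-trans (≤-reflexive (sym (count-remove p))) c≤1)) λ { (s≤s ()) }
    where
    sum-pos : 1 ≤ count (λ j → P? j ×-dec ¬? (j ≟ i))
    sum-pos = ≤-trans (≤-reflexive (sym (𝟙-yes (P? j ×-dec ¬? (j ≟ i)) (q , j≢i)))) (term≤sum (λ j → 𝟙 (P? j ×-dec ¬? (j ≟ i))) j)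

  unique⇒count≤1 : (∀ {i j} → P i → P j → i ≡ j) → count P? ≤ 1
  unique⇒count≤1 unique with any? P?
  ... | no ¬∃P       = ≤-trans (≤-reflexive (count-none (λ p → ¬∃P (_ , p)))) z≤n
  ... | yes (i , p) = ≤-reflexive (trans (count-remove p)
                        (cong suc (sum-zero (λ j → 𝟙-no (P? j ×-dec ¬? (j ≟ i)) (λ (q , j≢i) → j≢i (unique q p))))))

count-single : ∀ {n} (x : Fin n) → count (λ y → y ≟ x) ≡ 1
count-single x = trans (count-remove (_≟ x) {x} refl)
  (cong suc (count-none (λ j → (j ≟ x) ×-dec ¬? (j ≟ x)) (λ (p , ¬p) → ¬p p)))

sum-fibres : ∀ {m n} (c : Fin m → Fin n) (f : Fin m → ℕ) →
             sum f ≡ sum (λ x → sum (λ i → 𝟙 (x ≟ c i) * f i))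
sum-fibres {m} {n} c f = begin
  sum f ≡⟨ sum-cong-≗ (λ i → term i) ⟩
  sum (λ i → sum (λ x → 𝟙 (x ≟ c i) * f i)) ≡⟨ ∑-comm (λ i x → 𝟙 (x ≟ c i) * f i) ⟩
  sum (λ x → sum (λ i → 𝟙 (x ≟ c i) * f i)) ∎
  where
  open ≡-Reasoning
  term : ∀ i → f i ≡ sum (λ x → 𝟙 (x ≟ c i) * f i)
  term i = begin
    f i                                   ≡⟨ *-identityʳ (f i) ⟨
    f i * 1                               ≡⟨ cong (f i *_) (count-single (c i)) ⟨
    f i * sum (λ x → 𝟙 (x ≟ c i))         ≡⟨ *-distribˡ-sum (f i) (λ x → 𝟙 (x ≟ c i)) ⟩
    sum (λ x → f i * 𝟙 (x ≟ c i))         ≡⟨ sum-cong-≗ (λ x → *-comm (f i) (𝟙 (x ≟ c i))) ⟩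
    sum (λ x → 𝟙 (x ≟ c i) * f i)         ∎

count-fibres : ∀ {m n} {P : Pred (Fin m) 0ℓ} (P? : Decidable P) (c : Fin m → Fin n) →
               count P? ≡ sum (λ x → count (λ i → (x ≟ c i) ×-dec P? i))
count-fibres P? c = trans (sum-fibres c (λ i → 𝟙 (P? i)))
  (sum-cong-≗ (λ x → sum-cong-≗ (λ i → sym (𝟙-× (x ≟ c i) (P? i)))))

count-∃ : ∀ {n k} {Q : Fin k → Pred (Fin n) 0ℓ} (Q? : ∀ l → Decidable (Q l)) →
          count (λ x → any? (λ l → Q? l x)) ≤ sum (λ l → count (Q? l))
count-∃ Q? = ≤-trans (sum-mono (λ x → bound x (any? (λ l → Q? l x)))) (≤-reflexive (∑-comm (λ x l → 𝟙 (Q? l x))))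
  where
  bound : ∀ x (d : Dec _) → 𝟙 d ≤ sum (λ l → 𝟙 (Q? l x))
  bound x (yes (l , q)) = count-pos (λ l → Q? l x) q
  bound x (no _)        = z≤n

count-at : ∀ {n} {P : Pred (Fin n) 0ℓ} (P? : Decidable P) y → count (λ x → (x ≟ y) ×-dec P? x) ≤ 𝟙 (P? y)
count-at {P = P} P? y = go (P? y)
  where
  go : (d : Dec (P y)) → count (λ x → (x ≟ y) ×-dec P? x) ≤ 𝟙 d
  go (yes _) = unique⇒count≤1 (λ x → (x ≟ y) ×-dec P? x) λ (q , _) (r , _) → trans q (sym r)
  go (no ¬p) = ≤-reflexive (count-none (λ x → (x ≟ y) ×-dec P? x) λ { (refl , p) → ¬p p })

∈image? : ∀ {n k} (a : Fin k → Fin n) → Decidable (λ x → ∃[ l ] x ≡ a l)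
∈image? a x = any? (λ l → x ≟ a l)

-- An excluded point is charged only if it satisfies P. The capacity count depends on this: a centre
-- costs a target only for the colour that it misses.
count-avoid : ∀ {n k} {P : Pred (Fin n) 0ℓ} (P? : Decidable P) (a : Fin k → Fin n) →
              count P? ≤ count (λ x → P? x ×-dec ¬? (∈image? a x)) + sum (λ l → 𝟙 (P? (a l)))
count-avoid P? a = ≤-trans
  (count-cover P? (λ x → P? x ×-dec ¬? (∈image? a x)) (λ x → any? (λ l → (x ≟ a l) ×-dec P? x)) λ {x} p → split x p (∈image? a x))
  (+-monoʳ-≤ _ (≤-trans (count-∃ (λ l x → (x ≟ a l) ×-dec P? x)) (sum-mono (λ l → count-at P? (a l)))))
  where
  split : ∀ x → _ → Dec (∃[ l ] x ≡ a l) → _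
  split x p (yes (l , q)) = inj₂ (l , q , p)
  split x p (no ¬q)       = inj₁ (p , ¬q)

-- Greedy: each index in P takes a witness of Q, which is then withdrawn. `x₀` is a dummy value for
-- the indices outside P.
inject : ∀ {m n} {P : Pred (Fin m) 0ℓ} (P? : Decidable P) {Q : Pred (Fin n) 0ℓ} (Q? : Decidable Q) →
         Fin n → count P? ≤ count Q? →
         Σ (Fin m → Fin n) λ φ → (∀ {i} → P i → Q (φ i)) × (∀ {i j} → P i → P j → φ i ≡ φ j → i ≡ j)
inject {zero} P? Q? x₀ P≤Q = (λ ()) , (λ { {()} }) , λ { {()} }
inject {suc m} {n} {P} P? {Q} Q? x₀ P≤Q = go (P? zero) P≤Q
  where
  Injection : Set
  Injection = Σ (Fin (suc m) → Fin n) λ φ → (∀ {i} → P i → Q (φ i)) × (∀ {i j} → P i → P j → φ i ≡ φ j → i ≡ j)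
  go : (d : Dec (P zero)) → 𝟙 d + count (P? ∘ suc) ≤ count Q? → Injection
  go (no ¬p) P≤Q with inject (P? ∘ suc) Q? x₀ P≤Q
  ... | φ , φ-Q , φ-inj = (x₀ ◂ φ) , (λ { {zero} p → contradiction p ¬p ; {suc i} p → φ-Q p })
        , λ { {zero} p _ _ → contradiction p ¬p ; {suc i} {zero} _ p _ → contradiction p ¬p
            ; {suc i} {suc j} p p′ q → cong suc (φ-inj p p′ q) }
  go (yes p) P<Q with count-witness Q? (≤-trans (s≤s z≤n) P<Q)
  ... | x , Qx with inject (P? ∘ suc) (λ y → Q? y ×-dec ¬? (y ≟ x)) x₀ (s≤s⁻¹ (≤-trans P<Q (≤-reflexive (count-remove Q? Qx))))
  ... | φ , φ-Q , φ-inj = (x ◂ φ) , (λ { {zero} _ → Qx ; {suc i} p → proj₁ (φ-Q p) })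
        , λ { {zero} {zero} _ _ _ → refl
            ; {zero} {suc j} _ p′ q → contradiction (sym q) (proj₂ (φ-Q p′))
            ; {suc i} {zero} p _ q → contradiction q (proj₂ (φ-Q p))
            ; {suc i} {suc j} p p′ q → cong suc (φ-inj p p′ q) }

sum-++ : ∀ m {n} (f : Fin (m + n) → ℕ) → sum f ≡ sum (λ i → f (i ↑ˡ n)) + sum (λ i → f (m ↑ʳ i))
sum-++ zero    f = refl
sum-++ (suc m) f = trans (cong (f zero +_) (sum-++ m (f ∘ suc))) (sym (+-assoc (f zero) _ _))

-- The two ends of all demands compete for the same targets, so one injection is taken from two
-- disjoint copies of the index set, encoded as `Fin (m + m)`.
inject-halves : ∀ {m n} {P : Bool → Pred (Fin m) 0ℓ} (P? : ∀ b → Decidable (P b)) {Q : Pred (Fin n) 0ℓ} (Q? : Decidable Q) →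
         Fin n → count (P? true) + count (P? false) ≤ count Q? →
         Σ (Fin m → Bool → Fin n) λ φ → (∀ {i b} → P b i → Q (φ i b))
           × (∀ {i j b c} → P b i → P c j → φ i b ≡ φ j c → i ≡ j × b ≡ c)
inject-halves {m} {n} {P} P? {Q} Q? x₀ P≤Q = from (inject P̂? Q? x₀ (subst (_≤ count Q?) (sym total) P≤Q))
  where
  P̂ : Pred (Fin (m + m)) 0ℓ
  P̂ h = [ P true , P false ]′ (splitAt m h)
  P̂? : Decidable P̂
  P̂? h with splitAt m h
  ... | inj₁ i = P? true i
  ... | inj₂ i = P? false i
  half : Bool → Fin m → Fin (m + m)
  half true  i = i ↑ˡ m
  half false i = m ↑ʳ i
  to : ∀ {b i} → P b i → P̂ (half b i)
  to {true}  {i} p rewrite splitAt-↑ˡ m i m = p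
  to {false} {i} p rewrite splitAt-↑ʳ m m i = p
  back : ∀ {b i} → P̂ (half b i) → P b i
  back {true}  {i} p rewrite splitAt-↑ˡ m i m = p
  back {false} {i} p rewrite splitAt-↑ʳ m m i = p
  half-injective : ∀ {b c i j} → half b i ≡ half c j → i ≡ j × b ≡ c
  half-injective {true}  {true}  {i} {j} q = ↑ˡ-injective m i j q , refl
  half-injective {false} {false} {i} {j} q = ↑ʳ-injective m i j q , refl
  half-injective {true}  {false} {i} {j} q with trans (sym (splitAt-↑ˡ m i m)) (trans (cong (splitAt m) q) (splitAt-↑ʳ m m j))
  ... | ()
  half-injective {false} {true}  {i} {j} q with trans (sym (splitAt-↑ʳ m m i)) (trans (cong (splitAt m) q) (splitAt-↑ˡ m j m))
  ... | ()
  total : count P̂? ≡ count (P? true) + count (P? false)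
  total = trans (sum-++ m (λ h → 𝟙 (P̂? h)))
                (cong₂ _+_ (count-cong (λ i → P̂? (i ↑ˡ m)) (P? true) (back {true}) (to {true}))
                           (count-cong (λ i → P̂? (m ↑ʳ i)) (P? false) (back {false}) (to {false})))
  from : (Σ (Fin (m + m) → Fin n) λ φ → (∀ {h} → P̂ h → Q (φ h)) × (∀ {h h′} → P̂ h → P̂ h′ → φ h ≡ φ h′ → h ≡ h′)) →
         Σ (Fin m → Bool → Fin n) λ φ → (∀ {i b} → P b i → Q (φ i b))
           × (∀ {i j b c} → P b i → P c j → φ i b ≡ φ j c → i ≡ j × b ≡ c)
  from (φ , φ-Q , φ-inj) = (λ i b → φ (half b i)) , (λ p → φ-Q (to p)) , λ p p′ q → half-injective (φ-inj (to p) (to p′) q)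

count-halves≤1 : ∀ {m} {P : Bool → Pred (Fin m) 0ℓ} (P? : ∀ b → Decidable (P b)) →
                 (∀ {i j b c} → P b i → P c j → i ≡ j × b ≡ c) → count (P? true) + count (P? false) ≤ 1
count-halves≤1 {m} {P} P? unique = go (any? (P? true))
  where
  ≤1 : ∀ b → count (P? b) ≤ 1
  ≤1 b = unique⇒count≤1 (P? b) λ p p′ → proj₁ (unique p p′)
  go : Dec (∃ (P true)) → count (P? true) + count (P? false) ≤ 1
  go (no ¬p) = ≤-trans (≤-reflexive (cong (_+ count (P? false)) (count-none (P? true) (λ p → ¬p (_ , p))))) (≤1 false)
  go (yes (_ , p)) = ≤-trans (≤-reflexive (trans (cong (count (P? true) +_) (count-none (P? false) λ p′ → contradiction (proj₂ (unique p p′)) λ ())) (+-identityʳ _))) (≤1 true)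


-- Balanced orientations of multigraphs

not-≢ : ∀ {b c} → b ≢ c → not b ≡ c
not-≢ {true}  {true}  b≢c = contradiction refl b≢c
not-≢ {true}  {false} b≢c = refl
not-≢ {false} {true}  b≢c = refl
not-≢ {false} {false} b≢c = contradiction refl b≢c

≡⇒not-≢ : ∀ {b c : Bool} → b ≡ c → not b ≢ c
≡⇒not-≢ {true}  refl ()
≡⇒not-≢ {false} refl ()

module Orientation {W : Set} (_≟ʷ_ : DecidableEquality W) where

  atEnd? : ∀ {m} {A : Pred (Fin m) 0ℓ} → Decidable A → (e : Fin m → Bool → W) (σ : Fin m → Bool) (w : W) →
           Decidable (λ i → A i × e i (σ i) ≡ w)
  atEnd? A? e σ w i = A? i ×-dec (e i (σ i) ≟ʷ w)

  ends : ∀ {m} {A : Pred (Fin m) 0ℓ} → Decidable A → (Fin m → Bool → W) → (Fin m → Bool) → W → ℕ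
  ends A? e σ w = count (atEnd? A? e σ w)

  -- `o i` selects an end of edge i, and `not ∘ o` is the reversed orientation. Loops are allowed,
  -- since merging two parallel edges creates them.
  Balanced : ∀ {m} {A : Pred (Fin m) 0ℓ} → Decidable A → (Fin m → Bool → W) → (Fin m → Bool) → Set
  Balanced A? e o = ∀ w → ends A? e o w ≤ suc (ends A? e (not ∘ o) w)
                        × ends A? e (not ∘ o) w ≤ suc (ends A? e o w)

  module _ {m} {A : Pred (Fin (suc m)) 0ℓ} (A? : Decidable A) (e : Fin (suc m) → Bool → W) where

    A⁺? : Decidable (A ∘ suc)
    A⁺? = A? ∘ suc

    -- Edge 0 and edge i share the vertex e zero b = e (suc i) c: they are replaced by a single
    -- edge joining their other ends, and an orientation of it is transported back through the
    -- shared vertex.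
    module Splice (i : Fin m) (b c : Bool) (shared : e (suc i) c ≡ e zero b)
                  (a₀ : A zero) (aᵢ : A (suc i)) where

      e′ : Fin m → Bool → W
      e′ j d with j ≟ i | d Bool.≟ c
      ... | yes _ | yes _ = e zero (not b)
      ... | _     | _     = e (suc j) d

      e′-at : e′ i c ≡ e zero (not b)
      e′-at with i ≟ i | c Bool.≟ c
      ... | yes _  | yes _   = refl
      ... | yes _  | no c≢c  = contradiction refl c≢c
      ... | no i≢i | _       = contradiction refl i≢i

      e′-off : ∀ {j d} → j ≢ i ⊎ d ≢ c → e′ j d ≡ e (suc j) d
      e′-off {j} {d} off with j ≟ i | d Bool.≟ c
      ... | yes j≡i | yes d≡c = contradiction off λ { (inj₁ j≢i) → j≢i j≡i ; (inj₂ d≢c) → d≢c d≡c }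
      ... | yes _   | no _    = refl
      ... | no _    | yes _   = refl
      ... | no _    | no _    = refl

      Through : (Fin (suc m) → Bool) → Set
      Through τ = (τ (suc i) ≡ c × τ zero ≡ not b) ⊎ (τ (suc i) ≢ c × τ zero ≡ b)

      -- However the merged edge is directed, the two original edges run through the shared vertex:
      -- one of them selects it, the other selects what the merged edge selects. The reversed
      -- orientation gains the same term, so the balance survives.
      ends-splice : ∀ τ → Through τ → ∀ w → ends A? e τ w ≡ 𝟙 (e zero b ≟ʷ w) + ends A⁺? e′ (τ ∘ suc) w
      ends-splice τ (inj₁ (τi , τ0)) w = begin
        𝟙 (atEnd? A? e τ w zero) + sum f  ≡⟨ cong (_+ sum f) (𝟙-cong _ (e zero (not b) ≟ʷ w)
                                                (λ (_ , q) → trans (cong (e zero) (sym τ0)) q)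
                                                (λ q → a₀ , trans (cong (e zero) τ0) q)) ⟩
        𝟙 (e zero (not b) ≟ʷ w) + sum f   ≡⟨ +-comm _ (sum f) ⟩
        sum f + 𝟙 (e zero (not b) ≟ʷ w)   ≡⟨ cong (sum f +_) (𝟙-cong _ (atEnd? A⁺? e′ (τ ∘ suc) w i)
                                                (λ q → aᵢ , trans (trans (cong (e′ i) τi) e′-at) q)
                                                (λ (_ , q) → trans (sym (trans (cong (e′ i) τi) e′-at)) q)) ⟩
        sum f + g i                       ≡⟨ sum-replace f g i (λ j j≢i → 𝟙-cong (atEnd? A? e τ w (suc j)) (atEnd? A⁺? e′ (τ ∘ suc) w j)
                                                (map₂ (trans (e′-off (inj₁ j≢i))))
                                                (map₂ (trans (sym (e′-off (inj₁ j≢i)))))) ⟩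
        sum g + f i                       ≡⟨ +-comm (sum g) (f i) ⟩
        f i + sum g                       ≡⟨ cong (_+ sum g) (𝟙-cong (atEnd? A? e τ w (suc i)) (e zero b ≟ʷ w)
                                                (λ (_ , q) → trans (sym (trans (cong (e (suc i)) τi) shared)) q)
                                                (λ q → aᵢ , trans (trans (cong (e (suc i)) τi) shared) q)) ⟩
        𝟙 (e zero b ≟ʷ w) + sum g         ∎
        where
        open ≡-Reasoning
        f g : Fin m → ℕ
        f j = 𝟙 (atEnd? A? e τ w (suc j))
        g j = 𝟙 (atEnd? A⁺? e′ (τ ∘ suc) w j)
      ends-splice τ (inj₂ (τi , τ0)) w =
        cong₂ _+_ (𝟙-cong (atEnd? A? e τ w zero) (e zero b ≟ʷ w)
                    (λ (_ , q) → trans (cong (e zero) (sym τ0)) q)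
                    (λ q → a₀ , trans (cong (e zero) τ0) q))
                  (count-cong (λ j → atEnd? A? e τ w (suc j)) (atEnd? A⁺? e′ (τ ∘ suc) w)
                    (λ {j} → map₂ (trans (same j)))
                    (λ {j} → map₂ (trans (sym (same j)))))
        where
        off : ∀ {j} → Dec (j ≡ i) → j ≢ i ⊎ τ (suc j) ≢ c
        off (yes refl) = inj₂ τi
        off (no  j≢i)  = inj₁ j≢i
        same : ∀ j → e′ j (τ (suc j)) ≡ e (suc j) (τ (suc j))
        same j = e′-off (off (j ≟ i))

      splice : (Fin m → Bool) → Fin (suc m) → Bool
      splice o = (if does (o i Bool.≟ c) then not b else b) ◂ o

      through : ∀ o → Through (splice o) × Through (not ∘ splice o)
      through o with o i Bool.≟ c
      ... | yes oi≡c = inj₁ (oi≡c , refl) , inj₂ (≡⇒not-≢ oi≡c , Bool.not-involutive b)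
      ... | no  oi≢c = inj₂ (oi≢c , refl) , inj₁ (not-≢ oi≢c , refl)

      splice-balanced : ∀ o → Balanced A⁺? e′ o → Balanced A? e (splice o)
      splice-balanced o bal w rewrite ends-splice (splice o) (proj₁ (through o)) w
                                    | ends-splice (not ∘ splice o) (proj₂ (through o)) w =
        shift (proj₁ (bal w)) , shift (proj₂ (bal w))
        where
        shift : ∀ {k x y} → x ≤ suc y → k + x ≤ suc (k + y)
        shift {k} {x} {y} x≤ = ≤-trans (+-monoʳ-≤ k x≤) (≤-reflexive (+-suc k y))

    Touches : Bool → Pred (Fin m) 0ℓ
    Touches b i = A (suc i) × (e (suc i) true ≡ e zero b ⊎ e (suc i) false ≡ e zero b)

    touches? : ∀ b → Decidable (Touches b)
    touches? b i = A? (suc i) ×-dec ((e (suc i) true ≟ʷ e zero b) ⊎-dec (e (suc i) false ≟ʷ e zero b))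

    ends-inactive : ¬ A zero → ∀ τ w → ends A? e τ w ≡ ends A⁺? (e ∘ suc) (τ ∘ suc) w
    ends-inactive ¬a τ w = cong (_+ ends A⁺? (e ∘ suc) (τ ∘ suc) w) (𝟙-no (atEnd? A? e τ w zero) (¬a ∘ proj₁))

    inactive-balanced : ¬ A zero → ∀ o → Balanced A⁺? (e ∘ suc) o → Balanced A? e (true ◂ o)
    inactive-balanced ¬a o bal w rewrite ends-inactive ¬a (true ◂ o) w
                                       | ends-inactive ¬a (not ∘ (true ◂ o)) w = bal w

    -- Any direction will do: where edge 0 contributes an end, no other active edge has one, so the
    -- count there is 1.
    isolated-balanced : (∀ b i → ¬ Touches b i) → ∀ o → Balanced A⁺? (e ∘ suc) o → Balanced A? e (true ◂ o)
    isolated-balanced isolated o bal w =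
      compare (true ◂ o) (not ∘ (true ◂ o)) (proj₁ (bal w)) , compare (not ∘ (true ◂ o)) (true ◂ o) (proj₂ (bal w))
      where
      away : ∀ τ → (A zero × e zero (τ zero) ≡ w) → ends A⁺? (e ∘ suc) (τ ∘ suc) w ≡ 0
      away τ (_ , refl) = count-none (atEnd? A⁺? (e ∘ suc) (τ ∘ suc) w) λ { {i} (a , q) → isolated (τ zero) i (a , end i (τ (suc i)) q) }
        where
        end : ∀ i d → e (suc i) d ≡ e zero (τ zero) → e (suc i) true ≡ e zero (τ zero) ⊎ e (suc i) false ≡ e zero (τ zero)
        end i true  q = inj₁ q
        end i false q = inj₂ q
      compare : ∀ τ τ′ → ends A⁺? (e ∘ suc) (τ ∘ suc) w ≤ suc (ends A⁺? (e ∘ suc) (τ′ ∘ suc) w) →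
                ends A? e τ w ≤ suc (ends A? e τ′ w)
      compare τ τ′ le with atEnd? A? e τ w zero
      ... | yes p rewrite away τ p = s≤s z≤n
      ... | no _ = ≤-trans le (s≤s (m≤n+m _ _))

    touching-balanced : (∀ e′ → ∃[ o ] Balanced A⁺? e′ o) → A zero → ∀ {b i} → Touches b i → ∃[ o ] Balanced A? e o
    touching-balanced rec a {b} {i} (aᵢ , inj₁ q) =
      let open Splice i b true q a aᵢ ; (o , bal) = rec e′ in splice o , splice-balanced o bal
    touching-balanced rec a {b} {i} (aᵢ , inj₂ q) =
      let open Splice i b false q a aᵢ ; (o , bal) = rec e′ in splice o , splice-balanced o bal

    extend : (∀ e′ → ∃[ o ] Balanced A⁺? e′ o) → Dec (A zero) → Dec (∃ (Touches true)) → Dec (∃ (Touches false)) →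
             ∃[ o ] Balanced A? e o
    extend rec (no ¬a) _             _             = let (o , bal) = rec (e ∘ suc) in true ◂ o , inactive-balanced ¬a o bal
    extend rec (yes a) (yes (_ , t)) _             = touching-balanced rec a t
    extend rec (yes a) (no _)        (yes (_ , t)) = touching-balanced rec a t
    extend rec (yes a) (no ¬t)       (no ¬f)       =
      let (o , bal) = rec (e ∘ suc)
      in true ◂ o , isolated-balanced (λ { true i t → ¬t (i , t) ; false i t → ¬f (i , t) }) o bal

  abstract
    -- Merging edges replaces the usual decomposition into trails. The induction hypothesis ranges
    -- over all end functions because a merged edge has new ends.
    balanced-orientation : ∀ {m} {A : Pred (Fin m) 0ℓ} (A? : Decidable A) (e : Fin m → Bool → W) →
                           ∃[ o ] Balanced A? e o
    balanced-orientation {zero}  A? e = (λ ()) , λ w → z≤n , z≤n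
    balanced-orientation {suc m} A? e =
      extend A? e (balanced-orientation (A? ∘ suc)) (A? zero) (any? (touches? A? e true)) (any? (touches? A? e false))

-- König's edge colouring of bipartite multigraphs

at? : ∀ {m n} {A : Pred (Fin m) 0ℓ} → Decidable A → (e : Fin m → Bool → Fin n) → ∀ b x →
      Decidable (λ i → A i × e i b ≡ x)
at? A? e b x i = A? i ×-dec (e i b ≟ x)

ProperAt : ∀ {m n k} → Pred (Fin m) 0ℓ → (Fin m → Bool → Fin n) → Bool → (Fin m → Fin k) → Set
ProperAt A e b col = ∀ {i j} → A i → A j → e i b ≡ e j b → col i ≡ col j → i ≡ j

ends≤1 : ∀ {x y} → x + y ≤ 2 → x ≤ suc y → x ≤ 1
ends≤1 {zero}        _ _ = z≤n
ends≤1 {suc zero}    _ _ = ≤-refl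
ends≤1 {suc (suc x)} {y} (s≤s (s≤s x+y≤0)) (s≤s sx≤y) =
  contradiction (≤-trans sx≤y (≤-trans (m≤n+m y x) x+y≤0)) λ ()

module _ {m n k} {A : Pred (Fin (suc m)) 0ℓ} (A? : Decidable A) (e : Fin (suc m) → Bool → Fin n)
         (col : Fin m → Fin k) (proper : ∀ b → ProperAt (A ∘ suc) (e ∘ suc) b col) where

  Free : Bool → Fin k → Set
  Free b γ = ∀ {i} → A (suc i) → e (suc i) b ≡ e zero b → col i ≢ γ

  -- Pigeonhole: if all k colours occurred at this end, the arcs carrying them together with arc 0
  -- would be k + 1 arcs there.
  free-colour : A zero → ∀ b → count (at? A? e b (e zero b)) ≤ k → ∃ (Free b)
  free-colour a b deg≤k = let (γ , ¬used) = ¬∀⟶∃¬ k Used used? ¬all in γ , λ aᵢ q c → ¬used (_ , sym c , aᵢ , q)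
    where
    Used : Pred (Fin k) 0ℓ
    Used γ = ∃[ i ] (γ ≡ col i × A (suc i) × e (suc i) b ≡ e zero b)
    here? = at? (A? ∘ suc) (e ∘ suc) b (e zero b)
    used? : Decidable Used
    used? γ = any? (λ i → (γ ≟ col i) ×-dec here? i)
    ¬all : ¬ (∀ γ → Used γ)
    ¬all all = <⇒≱ (n<1+n k) (begin
      suc k ≤⟨ s≤s (n≤sum (λ γ → count-pos (λ i → (γ ≟ col i) ×-dec here? i) (proj₂ (all γ)))) ⟩
      suc (sum (λ γ → count (λ i → (γ ≟ col i) ×-dec here? i))) ≡⟨ cong suc (count-fibres here? col) ⟨
      suc (count here?) ≡⟨ cong (_+ count here?) (𝟙-yes (at? A? e b (e zero b) zero) (a , refl)) ⟨
      count (at? A? e b (e zero b)) ≤⟨ deg≤k ⟩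
      k ∎)
      where open ≤-Reasoning

  proper-∷ : ∀ {b γ} → Free b γ → ProperAt A e b (γ ◂ col)
  proper-∷ free {zero}  {zero}  _ _ _ _ = refl
  proper-∷ free {zero}  {suc j} _ a q c = contradiction (sym c) (free a (sym q))
  proper-∷ free {suc i} {zero}  a _ q c = contradiction c (free a q)
  proper-∷ {b} free {suc i} {suc j} a a′ q c = cong suc (proper b a a′ q c)

  -- The arcs coloured γ true or γ false, together with arc 0, meet every tail and every head at
  -- most twice, so a balanced orientation of them (tails and heads being regarded as different
  -- vertices) properly recolours them with these two colours.
  module Recolour (γ : Bool → Fin k) (γ-free : ∀ b → Free b (γ b)) (γ-distinct : γ true ≢ γ false) where

    -- Arc 0 belongs to this set through its provisional colour `γ true`.
    Kempe : Pred (Fin (suc m)) 0ℓ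
    Kempe i = ∃[ b ] (γ true ◂ col) i ≡ γ b

    kempe? : Decidable Kempe
    kempe? i with (γ true ◂ col) i ≟ γ true | (γ true ◂ col) i ≟ γ false
    ... | yes q | _     = yes (true , q)
    ... | no  _ | yes q = yes (false , q)
    ... | no ¬t | no ¬f = no λ { (true , q) → ¬t q ; (false , q) → ¬f q }

    sub? : Decidable (λ i → A i × Kempe i)
    sub? i = A? i ×-dec kempe? i

    ê : Fin (suc m) → Bool → Bool × Fin n
    ê i b = b , e i b

    open Orientation (≡-dec Bool._≟_ (_≟_ {n}))

    kempe-shade : ∀ b {i} → Kempe i → (γ b ◂ col) i ≡ γ true ⊎ (γ b ◂ col) i ≡ γ false
    kempe-shade true  {zero}  _           = inj₁ refl
    kempe-shade false {zero}  _           = inj₂ refl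
    kempe-shade b     {suc i} (true , q)  = inj₁ q
    kempe-shade b     {suc i} (false , q) = inj₂ q

    γ-injective : ∀ {b c} → γ b ≡ γ c → b ≡ c
    γ-injective {true}  {true}  _ = refl
    γ-injective {true}  {false} q = contradiction q γ-distinct
    γ-injective {false} {true}  q = contradiction (sym q) γ-distinct
    γ-injective {false} {false} _ = refl

    module _ (o : Fin (suc m) → Bool) (balanced : Balanced sub? ê o) where

      module _ (b : Bool) (x : Fin n) where

        -- On side b, arc 0 is provisionally given `γ b`, which is free there. The colouring is then
        -- proper on that side, and each of the two colours occurs at most once at x.
        sub-deg≤2 : count (at? sub? e b x) ≤ 2
        sub-deg≤2 = ≤-trans
          (count-cover (at? sub? e b x) (shade? true) (shade? false)
            (λ {i} ((a , κ) , q) → [ (λ c → inj₁ (a , q , c)) , (λ c → inj₂ (a , q , c)) ]′ (kempe-shade b {i} κ)))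
          (+-mono-≤ (shade≤1 true) (shade≤1 false))
          where
          shade? : ∀ c → Decidable (λ i → A i × e i b ≡ x × (γ b ◂ col) i ≡ γ c)
          shade? c i = A? i ×-dec (e i b ≟ x) ×-dec ((γ b ◂ col) i ≟ γ c)
          shade≤1 : ∀ c → count (shade? c) ≤ 1
          shade≤1 c = unique⇒count≤1 (shade? c) λ (a , q , s) (a′ , q′ , s′) →
            proper-∷ (γ-free b) a a′ (trans q (sym q′)) (trans s (sym s′))

        out in′ : ℕ
        out = ends sub? ê o (b , x)
        in′ = ends sub? ê (not ∘ o) (b , x)

        out+in≤2 : out + in′ ≤ 2
        out+in≤2 = subst (_≤ 2) (trans (count-split (at? sub? e b x) (λ i → o i Bool.≟ b)) (cong₂ _+_
            (count-cong (λ i → at? sub? e b x i ×-dec (o i Bool.≟ b)) (atEnd? sub? ê o (b , x))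
              (λ { ((s , refl) , refl) → s , refl }) (λ { (s , refl) → (s , refl) , refl }))
            (count-cong (λ i → at? sub? e b x i ×-dec ¬? (o i Bool.≟ b)) (atEnd? sub? ê (not ∘ o) (b , x))
              (λ { {i} ((s , q) , oi≢b) → s , cong₂ _,_ (not-≢ oi≢b) (trans (cong (e i) (not-≢ oi≢b)) q) })
              (λ { {i} (s , refl) → (s , refl) , λ q → ≡⇒not-≢ q refl }))))
          sub-deg≤2

        out≤1 : out ≤ 1
        out≤1 = ends≤1 out+in≤2 (proj₁ (balanced (b , x)))

        in≤1 : in′ ≤ 1
        in≤1 = ends≤1 (subst (_≤ 2) (+-comm out in′) out+in≤2) (proj₂ (balanced (b , x)))

      -- Two arcs that share their end on side b and have the same direction both leave or both
      -- enter that vertex, whereas balance with degree at most 2 admits one of each. Hence the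
      -- direction can serve as the new colour.
      sub-unique : ∀ {b i j} → A i × Kempe i → A j × Kempe j → e i b ≡ e j b → o i ≡ o j → i ≡ j
      sub-unique {b} {i} {j} s s′ q p = go (o i Bool.≟ b)
        where
        go : Dec (o i ≡ b) → i ≡ j
        go (yes oi) = count≤1⇒unique (atEnd? sub? ê o (b , e j b)) (out≤1 b (e j b))
                        (s , cong₂ _,_ oi (trans (cong (e i) oi) q)) (s′ , cong₂ _,_ oj (cong (e j) oj))
          where oj = trans (sym p) oi
        go (no oi≢b) = count≤1⇒unique (atEnd? sub? ê (not ∘ o) (b , e j b)) (in≤1 b (e j b))
                         (s , cong₂ _,_ oi (trans (cong (e i) oi) q)) (s′ , cong₂ _,_ oj (cong (e j) oj))
          where oi = not-≢ oi≢b
                oj = trans (cong not (sym p)) oi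

      pick : ∀ i → Dec (Kempe i) → Fin k
      pick i (yes _) = γ (o i)
      pick i (no _)  = (γ true ◂ col) i

      colour : Fin (suc m) → Fin k
      colour i = pick i (kempe? i)

      colour-proper : ∀ b → ProperAt A e b colour
      colour-proper b {i} {j} a a′ q c = go (kempe? i) (kempe? j) c
        where
        go : (p : Dec (Kempe i)) (p′ : Dec (Kempe j)) → pick i p ≡ pick j p′ → i ≡ j
        go (yes κ) (yes κ′) c = sub-unique (a , κ) (a′ , κ′) q (γ-injective c)
        go (yes _) (no ¬κ)  c = contradiction (o i , sym c) ¬κ
        go (no ¬κ) (yes _)  c = contradiction (o j , c) ¬κ
        go (no ¬κ) (no ¬κ′) c = old i j a a′ q ¬κ ¬κ′ c
          where
          old : ∀ i j → A i → A j → e i b ≡ e j b → ¬ Kempe i → ¬ Kempe j → (γ true ◂ col) i ≡ (γ true ◂ col) j → i ≡ j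
          old zero    _       _ _  _ ¬κ _ _ = contradiction (true , refl) ¬κ
          old (suc _) zero    _ _  _ _ ¬κ _ = contradiction (true , refl) ¬κ
          old (suc i) (suc j) a a′ q _ _  c = cong suc (proper b a a′ q c)

  insert-arc : A zero → (∀ b x → count (at? A? e b x) ≤ k) → ∃[ c ] (∀ b → ProperAt A e b c)
  insert-arc a deg≤k = go (free true) (free false)
    where
    free : ∀ b → ∃ (Free b)
    free b = free-colour a b (deg≤k b (e zero b))
    go : ∃ (Free true) → ∃ (Free false) → ∃[ c ] (∀ b → ProperAt A e b c)
    go (α , fα) (β , fβ) with α ≟ β
    ... | yes refl = α ◂ col , λ { true → proper-∷ fα ; false → proper-∷ fβ }
    ... | no α≢β   = recolour (balanced-orientation sub? ê)
      where
      open Orientation (≡-dec Bool._≟_ (_≟_ {n})) using (Balanced; balanced-orientation)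
      γ : Bool → Fin k
      γ true  = α
      γ false = β
      γ-free : ∀ b → Free b (γ b)
      γ-free true  = fα
      γ-free false = fβ
      open Recolour γ γ-free α≢β
      recolour : ∃[ o ] Balanced sub? ê o → ∃[ c ] (∀ b → ProperAt A e b c)
      recolour (o , balanced) = colour o balanced , colour-proper o balanced

könig : ∀ {m n k} {A : Pred (Fin m) 0ℓ} (A? : Decidable A) (e : Fin m → Bool → Fin n) →
        (∀ b x → count (at? A? e b x) ≤ suc k) → ∃[ c ] (∀ b → ProperAt {k = suc k} A e b c)
könig {zero}          A? e deg≤k = (λ ()) , λ { b {()} }
könig {suc m} {k = k} {A} A? e deg≤k =
  let (col , proper) = könig {k = k} (A? ∘ suc) (e ∘ suc) (λ b x → ≤-trans (m≤n+m _ _) (deg≤k b x))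
  in insert (A? zero) col proper
  where
  insert : Dec (A zero) → (col : Fin m → Fin (suc k)) → (∀ b → ProperAt (A ∘ suc) (e ∘ suc) b col) →
           ∃[ c ] (∀ b → ProperAt {k = suc k} A e b c)
  insert (yes a) col proper = insert-arc A? e col proper a deg≤k
  -- An inactive arc receives the dummy colour `zero`, which requires at least one colour: hence
  -- `suc k`.
  insert (no ¬a) col proper = zero ◂ col , λ b → λ
    { {zero}          a _ _ _ → contradiction a ¬a
    ; {suc i} {zero}  _ a _ _ → contradiction a ¬a
    ; {suc i} {suc j} a a′ q c → cong suc (proper b a a′ q c) }

-- Splitting off two partial permutations

_≟ᴹ_ : DecidableEquality (Maybe Bool)
_≟ᴹ_ = Maybe.≡-dec Bool._≟_

-- `just true` and `just false` name the two factors; `nothing` covers the other active arcs and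
-- also the inactive ones, which is why `rest-degree` asks for activity again.
record TwoFactors {m n} {A : Pred (Fin m) 0ℓ} (A? : Decidable A) (e : Fin m → Bool → Fin n) (k : ℕ) : Set where
  field
    class        : Fin m → Maybe Bool
    class-active : ∀ {i f} → class i ≡ just f → A i
    class-proper : ∀ {i j f} b → class i ≡ just f → class j ≡ just f → e i b ≡ e j b → i ≡ j
    rest-degree  : ∀ b x → count (at? (λ i → A? i ×-dec (class i ≟ᴹ nothing)) e b x) ≤ k

two-factors : ∀ {m n k} {A : Pred (Fin m) 0ℓ} (A? : Decidable A) (e : Fin m → Bool → Fin n) →
              (∀ b x → count (at? A? e b x) ≤ suc (suc k)) → TwoFactors A? e k
two-factors {m} {n} {k} {A} A? e deg≤ = from-colouring (könig A? e deg≤)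
  where
  label : Fin (suc (suc k)) → Maybe Bool
  label zero          = just true
  label (suc zero)    = just false
  label (suc (suc _)) = nothing

  label-injective : ∀ {c d f} → label c ≡ just f → label d ≡ just f → c ≡ d
  label-injective {zero}     {zero}     refl refl = refl
  label-injective {zero}     {suc zero} refl ()
  label-injective {zero}     {suc (suc _)} refl ()
  label-injective {suc zero} {suc zero} refl refl = refl
  label-injective {suc zero} {zero} refl ()
  label-injective {suc zero} {suc (suc _)} refl ()

  from-colouring : ∃[ c ] (∀ b → ProperAt {k = suc (suc k)} A e b c) → TwoFactors A? e k
  from-colouring (c , proper) = record
    { class        = λ i → class′ i (A? i)
    ; class-active = λ {i} → active (A? i)
    ; class-proper = λ {i} {j} b p q r → proper b (active (A? i) p) (active (A? j) q) r
                       (label-injective (labelled (A? i) p) (labelled (A? j) q))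
    ; rest-degree  = rest
    }
    where
    class′ : ∀ i → Dec (A i) → Maybe Bool
    class′ i (yes _) = label (c i)
    class′ i (no _)  = nothing

    active : ∀ {i f} (a? : Dec (A i)) → class′ i a? ≡ just f → A i
    active (yes a) _ = a

    labelled : ∀ {i f} (a? : Dec (A i)) → class′ i a? ≡ just f → label (c i) ≡ just f
    labelled (yes _) q = q

    unlabelled : ∀ {i} (a? : Dec (A i)) → A i → class′ i a? ≡ nothing → label (c i) ≡ nothing
    unlabelled (yes _) _ q = q
    unlabelled (no ¬a) a _ = contradiction a ¬a

    rest : ∀ b x → count (at? (λ i → A? i ×-dec (class′ i (A? i) ≟ᴹ nothing)) e b x) ≤ k
    rest b x = begin
      count R? ≡⟨ count-fibres R? c ⟩
      -- The first two colours became the factors, so k colour classes remain, with at most one arc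
      -- each at x.
      sum (λ d → count (coloured? d)) ≡⟨ cong₂ _+_ (none zero λ ()) (cong (_+ sum (λ d → count (coloured? (suc (suc d))))) (none (suc zero) λ ())) ⟩
      sum (λ d → count (coloured? (suc (suc d)))) ≤⟨ sum-≤-const 1 (λ d → unique⇒count≤1 (coloured? (suc (suc d)))
                 λ { (q , (a , _) , r) (q′ , (a′ , _) , r′) → proper b a a′ (trans r (sym r′)) (trans (sym q) q′) }) ⟩
      k * 1 ≡⟨ *-identityʳ k ⟩
      k ∎
      where
      open ≤-Reasoning
      R? = at? (λ i → A? i ×-dec (class′ i (A? i) ≟ᴹ nothing)) e b x
      coloured? = λ d i → (d ≟ c i) ×-dec R? i
      none : ∀ d → label d ≢ nothing → count (coloured? d) ≡ 0
      none d l≢ = count-none (coloured? d) λ { {i} (refl , (a , q) , _) → l≢ (unlabelled (A? i) a q) }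

-- Chains of a partial injection

sum-split : ∀ a {b} (g : ℕ → ℕ) →
            sum {a + b} (g ∘ toℕ) ≡ sum {a} (g ∘ toℕ) + sum {b} (λ p → g (a + toℕ p))
sum-split zero    g = refl
sum-split (suc a) g = trans (cong (g 0 +_) (sum-split a (g ∘ suc))) (sym (+-assoc (g 0) _ _))

module _ {n} {S : Pred (Fin n) 0ℓ} (S? : Decidable S) where

  -- Every vertex y of S is the element number pos y of the chain comp y, which has length
  -- len (comp y) and is read cyclically when it is closed; tally says that the positions in a
  -- chain are occupied exactly once.
  record Chains {m} (F : Pred (Fin m) 0ℓ) (e : Fin m → Bool → Fin n) : Set where
    field
      comp  : Fin n → Fin n
      pos   : Fin n → ℕ
      len   : Fin n → ℕ
      tally : ∀ x (g : ℕ → ℕ) → sum (λ y → 𝟙 (S? y ×-dec (comp y ≟ x)) * g (pos y)) ≡ sum {len x} (g ∘ toℕ)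
      same  : ∀ {i} → F i → comp (e i true) ≡ comp (e i false)
      next  : ∀ {i} → F i → pos (e i false) ≡ suc (pos (e i true))
                          ⊎ suc (pos (e i true)) ≡ len (comp (e i true)) × pos (e i false) ≡ 0
      last  : ∀ {y} → S y → (∀ {i} → F i → e i true ≢ y) → suc (pos y) ≡ len (comp y)
      first : ∀ {y} → S y → (∀ {i} → F i → e i false ≢ y) → pos y ≡ 0

    private
      here? : ∀ x p → Decidable (λ y → (S y × comp y ≡ x) × pos y ≡ p)
      here? x p y = (S? y ×-dec (comp y ≟ x)) ×-dec (pos y ℕ.≟ p)

      position? : ∀ x p → Decidable (λ (q : Fin (len x)) → toℕ q ≡ p)
      position? x p q = toℕ q ℕ.≟ p

      -- The indicator of position p as weight turns the tally into a statement about that one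
      -- position.
      occupied : ∀ x p → count (here? x p) ≡ count (position? x p)
      occupied x p = trans (sum-cong-≗ (λ y → 𝟙-× (S? y ×-dec (comp y ≟ x)) (pos y ℕ.≟ p))) (tally x (λ q → 𝟙 (q ℕ.≟ p)))

    pos<len : ∀ {y} → S y → pos y < len (comp y)
    pos<len {y} s with count-witness (position? (comp y) (pos y))
                         (subst (1 ≤_) (occupied (comp y) (pos y)) (count-pos (here? (comp y) (pos y)) ((s , refl) , refl)))
    ... | q , q≡pos = subst (_< len (comp y)) q≡pos (toℕ<n q)

    pos-injective : ∀ {y z} → S y → S z → comp y ≡ comp z → pos y ≡ pos z → y ≡ z
    pos-injective {y} {z} s s′ c p = count≤1⇒unique (here? (comp z) (pos z))
      (subst (_≤ 1) (sym (occupied (comp z) (pos z)))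
        (unique⇒count≤1 (position? (comp z) (pos z)) λ q r → toℕ-injective (trans q (sym r))))
      ((s , c) , p) ((s′ , refl) , refl)

  module _ {m} {F : Pred (Fin (suc m)) 0ℓ} (e : Fin (suc m) → Bool → Fin n) (chains : Chains (F ∘ suc) (e ∘ suc)) where
    open Chains chains

    skip-arc : ¬ F zero → Chains F e
    skip-arc ¬f = record
      { comp = comp ; pos = pos ; len = len ; tally = tally
      ; same  = λ { {zero} f → contradiction f ¬f ; {suc i} f → same f }
      ; next  = λ { {zero} f → contradiction f ¬f ; {suc i} f → next f }
      ; last  = λ s ¬tail → last s ¬tail
      ; first = λ s ¬head → first s ¬head
      }

    module _ (f₀ : F zero) (F⊆S : ∀ b → S (e zero b))
             (proper : ∀ b {i} → F (suc i) → e (suc i) b ≢ e zero b) where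

      private
        u v : Fin n
        u = e zero true
        v = e zero false
        ℓ : ℕ
        ℓ = len (comp u)

      u-last : suc (pos u) ≡ ℓ
      u-last = last (F⊆S true) (proper true)

      v-first : pos v ≡ 0
      v-first = first (F⊆S false) (proper false)

      -- Here u is the last and v the first vertex of the same chain, so the arc turns it into a
      -- cycle and no vertex has to be renumbered.
      close-chain : comp u ≡ comp v → Chains F e
      close-chain closed = record
        { comp = comp ; pos = pos ; len = len ; tally = tally
        ; same  = λ { {zero} _ → closed ; {suc i} f → same f }
        ; next  = λ { {zero} _ → inj₂ (u-last , v-first) ; {suc i} f → next f }
        ; last  = λ s ¬tail → last s ¬tail
        ; first = λ s ¬head → first s ¬head
        }

      module Join (apart : comp u ≢ comp v) where

        -- The chain of v is appended to the chain of u: its positions are shifted by `ℓ`, and its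
        -- old name `comp v` now denotes an empty chain.
        comp′ : Fin n → Fin n
        comp′ y with comp y ≟ comp v
        ... | yes _ = comp u
        ... | no _  = comp y

        pos′ : Fin n → ℕ
        pos′ y with comp y ≟ comp v
        ... | yes _ = ℓ + pos y
        ... | no _  = pos y

        len′ : Fin n → ℕ
        len′ x with x ≟ comp u | x ≟ comp v
        ... | yes _ | _     = ℓ + len (comp v)
        ... | no _  | yes _ = 0
        ... | no _  | no _  = len x

        moved : ∀ {y} → comp y ≡ comp v → comp′ y ≡ comp u × pos′ y ≡ ℓ + pos y
        moved {y} q with comp y ≟ comp v
        ... | yes _ = refl , refl
        ... | no ¬q = contradiction q ¬q

        stayed : ∀ {y} → comp y ≢ comp v → comp′ y ≡ comp y × pos′ y ≡ pos y
        stayed {y} ¬q with comp y ≟ comp v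
        ... | yes q = contradiction q ¬q
        ... | no _  = refl , refl

        len-u : ∀ {x} → x ≡ comp u → len′ x ≡ ℓ + len (comp v)
        len-u {x} q with x ≟ comp u
        ... | yes _ = refl
        ... | no ¬q = contradiction q ¬q

        len-v : ∀ {x} → x ≡ comp v → len′ x ≡ 0
        len-v {x} q with x ≟ comp u | x ≟ comp v
        ... | yes r | _     = contradiction (trans (sym r) q) apart
        ... | no _  | yes _ = refl
        ... | no _  | no ¬q = contradiction q ¬q

        len-other : ∀ {x} → x ≢ comp u → x ≢ comp v → len′ x ≡ len x
        len-other {x} ¬q ¬r with x ≟ comp u | x ≟ comp v
        ... | yes q | _     = contradiction q ¬q
        ... | no _  | yes r = contradiction r ¬r
        ... | no _  | no _  = refl

        term : Fin n → (ℕ → ℕ) → Fin n → ℕ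
        term x g y = 𝟙 (S? y ×-dec (comp y ≟ x)) * g (pos y)

        term′ : Fin n → (ℕ → ℕ) → Fin n → ℕ
        term′ x g y = 𝟙 (S? y ×-dec (comp′ y ≟ x)) * g (pos′ y)

        same-term : ∀ {x x′ y} (g g′ : ℕ → ℕ) → (comp′ y ≡ x → comp y ≡ x′) → (comp y ≡ x′ → comp′ y ≡ x) →
                    (comp y ≡ x′ → g (pos′ y) ≡ g′ (pos y)) → term′ x g y ≡ term x′ g′ y
        same-term {x} {x′} {y} g g′ to from val = go (comp y ≟ x′)
          where
          indicator : 𝟙 (S? y ×-dec (comp′ y ≟ x)) ≡ 𝟙 (S? y ×-dec (comp y ≟ x′))
          indicator = 𝟙-cong (S? y ×-dec (comp′ y ≟ x)) (S? y ×-dec (comp y ≟ x′)) (map₂ to) (map₂ from)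
          go : Dec (comp y ≡ x′) → term′ x g y ≡ term x′ g′ y
          go (yes q) = cong₂ _*_ indicator (val q)
          go (no ¬q) = trans (cong (_* g (pos′ y)) (trans indicator zero-indicator)) (cong (_* g′ (pos y)) (sym zero-indicator))
            where zero-indicator = 𝟙-no (S? y ×-dec (comp y ≟ x′)) (¬q ∘ proj₂)

        zero-term : ∀ {x y} (g : ℕ → ℕ) → comp y ≢ x → term x g y ≡ 0
        zero-term {x} {y} g ¬q = cong (_* g (pos y)) (𝟙-no (S? y ×-dec (comp y ≟ x)) (¬q ∘ proj₂))

        tally′ : ∀ x g → sum (term′ x g) ≡ sum {len′ x} (g ∘ toℕ)
        tally′ x g = go (x ≟ comp u) (x ≟ comp v)
          where
          open ≡-Reasoning
          go : Dec (x ≡ comp u) → Dec (x ≡ comp v) → sum (term′ x g) ≡ sum {len′ x} (g ∘ toℕ)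
          go (yes refl) _ = begin
            sum (term′ (comp u) g)                                        ≡⟨ sum-cong-≗ (λ y → both y (comp y ≟ comp v)) ⟩
            sum (λ y → term (comp u) g y + term (comp v) (g ∘ (ℓ +_)) y)  ≡⟨ ∑-distrib-+ (term (comp u) g) _ ⟩
            sum (term (comp u) g) + sum (term (comp v) (g ∘ (ℓ +_)))      ≡⟨ cong₂ _+_ (tally (comp u) g) (tally (comp v) (g ∘ (ℓ +_))) ⟩
            sum {ℓ} (g ∘ toℕ) + sum {len (comp v)} (g ∘ (ℓ +_) ∘ toℕ)     ≡⟨ sum-split ℓ g ⟨
            sum {ℓ + len (comp v)} (g ∘ toℕ)                              ≡⟨ cong (λ l → sum {l} (g ∘ toℕ)) (len-u refl) ⟨
            sum {len′ (comp u)} (g ∘ toℕ)                                 ∎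
            where
            both : ∀ y → Dec (comp y ≡ comp v) → term′ (comp u) g y ≡ term (comp u) g y + term (comp v) (g ∘ (ℓ +_)) y
            both y (yes q) = trans (same-term g (g ∘ (ℓ +_)) (λ _ → q) (proj₁ ∘ moved) (cong g ∘ proj₂ ∘ moved))
                                   (cong (_+ term (comp v) (g ∘ (ℓ +_)) y) (sym (zero-term g (λ r → apart (trans (sym r) q)))))
            both y (no ¬q) = trans (same-term g g (trans (sym (proj₁ (stayed ¬q)))) (trans (proj₁ (stayed ¬q))) (λ _ → cong g (proj₂ (stayed ¬q))))
                                   (trans (sym (+-identityʳ _)) (cong (term (comp u) g y +_) (sym (zero-term (g ∘ (ℓ +_)) ¬q))))
          go (no _) (yes refl) = trans (sum-zero λ y → cong (_* g (pos′ y)) (𝟙-no (S? y ×-dec (comp′ y ≟ comp v)) (vacated y (comp y ≟ comp v) ∘ proj₂)))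
                                       (cong (λ l → sum {l} (g ∘ toℕ)) (sym (len-v refl)))
            where
            vacated : ∀ y → Dec (comp y ≡ comp v) → comp′ y ≢ comp v
            vacated y (yes q) r = apart (trans (sym (proj₁ (moved q))) r)
            vacated y (no ¬q) r = ¬q (trans (sym (proj₁ (stayed ¬q))) r)
          go (no x≢u) (no x≢v) = begin
            sum (term′ x g)         ≡⟨ sum-cong-≗ (λ y → unchanged y (comp y ≟ comp v)) ⟩
            sum (term x g)          ≡⟨ tally x g ⟩
            sum {len x} (g ∘ toℕ)   ≡⟨ cong (λ l → sum {l} (g ∘ toℕ)) (len-other x≢u x≢v) ⟨
            sum {len′ x} (g ∘ toℕ)  ∎
            where
            unchanged : ∀ y → Dec (comp y ≡ comp v) → term′ x g y ≡ term x g y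
            unchanged y (yes q) = same-term g g (λ r → contradiction (trans (sym r) (proj₁ (moved q))) x≢u)
                                                (λ r → contradiction (trans (sym r) q) x≢v)
                                                (λ r → contradiction (trans (sym r) q) x≢v)
            unchanged y (no ¬q) = same-term g g (trans (sym (proj₁ (stayed ¬q)))) (trans (proj₁ (stayed ¬q))) (λ _ → cong g (proj₂ (stayed ¬q)))

        same′ : ∀ {y z} → comp y ≡ comp z → comp′ y ≡ comp′ z
        same′ {y} {z} q = go (comp z ≟ comp v)
          where
          go : Dec (comp z ≡ comp v) → comp′ y ≡ comp′ z
          go (yes r) = trans (proj₁ (moved (trans q r))) (sym (proj₁ (moved r)))
          go (no ¬r) = trans (proj₁ (stayed (¬r ∘ trans (sym q)))) (trans q (sym (proj₁ (stayed ¬r))))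

        last-v : ∀ {y} → comp y ≡ comp v → suc (pos y) ≡ len (comp y) → suc (pos′ y) ≡ len′ (comp′ y)
        last-v {y} q l = begin
          suc (pos′ y)      ≡⟨ cong suc (proj₂ (moved q)) ⟩
          suc (ℓ + pos y)   ≡⟨ +-suc ℓ (pos y) ⟨
          ℓ + suc (pos y)   ≡⟨ cong (ℓ +_) (trans l (cong len q)) ⟩
          ℓ + len (comp v)  ≡⟨ len-u (proj₁ (moved q)) ⟨
          len′ (comp′ y)    ∎
          where open ≡-Reasoning

        last-other : ∀ {y} → comp y ≢ comp u → comp y ≢ comp v → suc (pos y) ≡ len (comp y) → suc (pos′ y) ≡ len′ (comp′ y)
        last-other {y} ¬q ¬r l = begin
          suc (pos′ y)    ≡⟨ cong suc (proj₂ (stayed ¬r)) ⟩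
          suc (pos y)     ≡⟨ l ⟩
          len (comp y)    ≡⟨ len-other ¬q ¬r ⟨
          len′ (comp y)   ≡⟨ cong len′ (proj₁ (stayed ¬r)) ⟨
          len′ (comp′ y)  ∎
          where open ≡-Reasoning

        last⇒≡u : ∀ {y} → S y → comp y ≡ comp u → suc (pos y) ≡ len (comp y) → y ≡ u
        last⇒≡u s q l = pos-injective s (F⊆S true) q (ℕ.suc-injective (trans l (trans (cong len q) (sym u-last))))

        first⇒≡v : ∀ {y} → S y → comp y ≡ comp v → pos y ≡ 0 → y ≡ v
        first⇒≡v s q z = pos-injective s (F⊆S false) q (trans z (sym v-first))

        -- A last vertex in the chain of u would be u itself, as positions are injective; all other
        -- last vertices stay last after appending.
        last′ : ∀ {y} → S y → y ≢ u → suc (pos y) ≡ len (comp y) → suc (pos′ y) ≡ len′ (comp′ y)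
        last′ {y} s y≢u l = go (comp y ≟ comp u) (comp y ≟ comp v)
          where
          go : Dec (comp y ≡ comp u) → Dec (comp y ≡ comp v) → suc (pos′ y) ≡ len′ (comp′ y)
          go (yes q) _       = contradiction (last⇒≡u s q l) y≢u
          go (no ¬q) (yes r) = last-v r l
          go (no ¬q) (no ¬r) = last-other ¬q ¬r l

        first′ : ∀ {y} → S y → y ≢ v → pos y ≡ 0 → pos′ y ≡ 0
        first′ {y} s y≢v z = go (comp y ≟ comp v)
          where
          go : Dec (comp y ≡ comp v) → pos′ y ≡ 0
          go (yes q) = contradiction (first⇒≡v s q z) y≢v
          go (no ¬q) = trans (proj₂ (stayed ¬q)) z

        consecutive : ∀ {y z} → comp y ≡ comp z → pos z ≡ suc (pos y) → pos′ z ≡ suc (pos′ y)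
        consecutive {y} {z} q p = go (comp z ≟ comp v)
          where
          go : Dec (comp z ≡ comp v) → pos′ z ≡ suc (pos′ y)
          go (yes r) = trans (proj₂ (moved r)) (trans (cong (ℓ +_) p)
                         (trans (+-suc ℓ _) (cong suc (sym (proj₂ (moved (trans q r)))))))
          go (no ¬r) = trans (proj₂ (stayed ¬r)) (trans p (cong suc (sym (proj₂ (stayed (¬r ∘ trans (sym q)))))))

        joined : (∀ {i} b → F i → S (e i b)) → Chains F e
        joined S-ends = record
          { comp = comp′ ; pos = pos′ ; len = len′ ; tally = tally′
          ; same  = λ { {zero} _ → trans (proj₁ (stayed apart)) (sym (proj₁ (moved refl))) ; {suc i} f → same′ (same f) }
          ; next  = λ { {zero} _ → inj₁ (trans (proj₂ (moved refl)) (trans (cong (ℓ +_) v-first) (trans (+-identityʳ ℓ)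
                                     (trans (sym u-last) (cong suc (sym (proj₂ (stayed apart))))))))
                      ; {suc i} f → [ inj₁ ∘ consecutive (same f)
                                    , (λ (l , z) → inj₂ ( last′ (S-ends true f) (proper true f) l
                                                        , first′ (S-ends false f) (proper false f) z)) ]′ (next f) }
          ; last  = λ s ¬tail → last′ s (λ { refl → ¬tail f₀ refl }) (last s ¬tail)
          ; first = λ s ¬head → first′ s (λ { refl → ¬head f₀ refl }) (first s ¬head)
          }

  singletons : ∀ {F : Pred (Fin 0) 0ℓ} {e : Fin 0 → Bool → Fin n} → Chains F e
  singletons = record
    { comp = id ; pos = λ _ → 0 ; len = λ x → 𝟙 (S? x)
    ; tally = λ x g → trans (sym (*-distribʳ-sum (g 0) (λ y → 𝟙 (S? y ×-dec (y ≟ x))))) (alone x g (S? x))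
    ; same = λ { {()} } ; next = λ { {()} }
    ; last = λ {y} s _ → sym (𝟙-yes (S? y) s) ; first = λ _ _ → refl
    }
    where
    alone : ∀ x g (s? : Dec (S x)) → count (λ y → S? y ×-dec (y ≟ x)) * g 0 ≡ sum {𝟙 s?} (g ∘ toℕ)
    alone x g (yes s) = cong (_* g 0)
      (trans (count-cong (λ y → S? y ×-dec (y ≟ x)) (_≟ x) proj₂ (λ { refl → s , refl })) (count-single x))
    alone x g (no ¬s) = cong (_* g 0) (count-none (λ y → S? y ×-dec (y ≟ x)) λ { (s , refl) → ¬s s })

  abstract
    chains : ∀ {m} {F : Pred (Fin m) 0ℓ} (F? : Decidable F) (e : Fin m → Bool → Fin n) →
             (∀ {i} b → F i → S (e i b)) → (∀ {i j} b → F i → F j → e i b ≡ e j b → i ≡ j) → Chains F e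
    chains {zero}  F? e S-ends proper = singletons
    chains {suc m} {F} F? e S-ends proper = add (F? zero)
      where
      rest : Chains (F ∘ suc) (e ∘ suc)
      rest = chains (F? ∘ suc) (e ∘ suc) S-ends (λ b f f′ q → suc-injective (proper b f f′ q))
      open Chains rest using (comp)
      add : Dec (F zero) → Chains F e
      add (no ¬f) = skip-arc e rest ¬f
      add (yes f) = link (comp (e zero true) ≟ comp (e zero false))
        where
        new : ∀ b {i} → F (suc i) → e (suc i) b ≢ e zero b
        new b f′ q = contradiction (proper b f′ f q) λ ()
        link : Dec (comp (e zero true) ≡ comp (e zero false)) → Chains F e
        link (yes q) = close-chain e rest f (λ b → S-ends b f) new q
        link (no ¬q) = Join.joined e rest f (λ b → S-ends b f) new ¬q S-ends

-- Three-colouring cycles and counting missing colours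

-- The colour pattern of a cycle of length L: the out-colours of its vertices are 012012…012 when
-- L = 3q, 012…0121 when L = 3q + 4 and 012…01201 when L = 3q + 2.
out : ℕ → ℕ → Fin 3
out 0 _ = 0F
out 1 _ = 0F
out 2 0 = 0F
out 2 (suc _) = 1F
out 3 0 = 0F
out 3 1 = 1F
out 3 (suc (suc _)) = 2F
out 4 0 = 0F
out 4 1 = 1F
out 4 2 = 2F
out 4 (suc (suc (suc _))) = 1F
out (suc (suc (suc (suc (suc L))))) 0 = 0F
out (suc (suc (suc (suc (suc L))))) 1 = 1F
out (suc (suc (suc (suc (suc L))))) 2 = 2F
out (suc (suc (suc (suc (suc L))))) (suc (suc (suc p))) = out (suc (suc L)) p

-- For L at least 2 this is the colour of the closing arc. For L = 1, an isolated vertex, it is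
-- chosen different from `out 1 0`, so that the two reserved colours differ there too.
final : ℕ → Fin 3
final 0 = 1F
final 1 = 1F
final 2 = 1F
final 3 = 2F
final 4 = 1F
final (suc (suc (suc (suc (suc L))))) = final (suc (suc L))

inn : ℕ → ℕ → Fin 3
inn L 0       = final L
inn L (suc p) = out L p

third : Fin 3 → Fin 3 → Fin 3
third 0F 0F = 0F
third 0F 1F = 2F
third 0F 2F = 1F
third 1F 0F = 2F
third 1F 1F = 0F
third 1F 2F = 0F
third 2F 0F = 1F
third 2F 1F = 0F
third 2F 2F = 0F

third-distinct : ∀ x y → x ≢ y → third x y ≢ x × third x y ≢ y
third-distinct = from-yes (all? λ x → all? λ y → ¬? (x ≟ y) →-dec (¬? (third x y ≟ x) ×-dec ¬? (third x y ≟ y)))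

spare : ℕ → ℕ → Fin 3
spare L p = third (inn L p) (out L p)

out-zero : ∀ L → out L 0 ≡ 0F
out-zero 0 = refl
out-zero 1 = refl
out-zero 2 = refl
out-zero 3 = refl
out-zero 4 = refl
out-zero (suc (suc (suc (suc (suc L))))) = refl

final≢0 : ∀ L → final L ≢ 0F
final≢0 0 ()
final≢0 1 ()
final≢0 2 ()
final≢0 3 ()
final≢0 4 ()
final≢0 (suc (suc (suc (suc (suc L))))) = final≢0 (suc (suc L))

inn≢out : ∀ L p → p < L → inn L p ≢ out L p
inn≢out L 0 _ q = final≢0 L (trans q (out-zero L))
inn≢out 1 (suc _) (s≤s ())
inn≢out 2 1 _ ()
inn≢out 2 (suc (suc _)) (s≤s (s≤s ()))
inn≢out 3 1 _ ()
inn≢out 3 2 _ ()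
inn≢out 3 (suc (suc (suc _))) (s≤s (s≤s (s≤s ())))
inn≢out 4 1 _ ()
inn≢out 4 2 _ ()
inn≢out 4 3 _ ()
inn≢out 4 (suc (suc (suc (suc _)))) (s≤s (s≤s (s≤s (s≤s ()))))
inn≢out (suc (suc (suc (suc (suc L))))) 1 _ ()
inn≢out (suc (suc (suc (suc (suc L))))) 2 _ ()
inn≢out (suc (suc (suc (suc (suc L))))) 3 _ q with trans q (out-zero (suc (suc L)))
... | ()
inn≢out (suc (suc (suc (suc (suc L))))) (suc (suc (suc (suc p)))) (s≤s (s≤s (s≤s p<))) =
  inn≢out (suc (suc L)) (suc p) p<

out-final : ∀ p → out (suc (suc p)) (suc p) ≡ final (suc (suc p))
out-final 0 = refl
out-final 1 = refl
out-final 2 = refl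
out-final (suc (suc (suc p))) = out-final p

spares : ℕ → Fin 3 → ℕ
spares L j = sum {L} (λ p → 𝟙 (spare L (toℕ p) ≟ j))

-- Prefixing the block 012 preserves the spare colour of the first position and everything after the
-- old first position; the spare colours 2, 0, 1 are added, once each.
spares-+3 : ∀ L j → spares (5 + L) j ≡ suc (spares (2 + L) j)
spares-+3 L j = peel (out-zero (2 + L)) j _
  where
  peel : ∀ {c} → c ≡ 0F → ∀ j r →
         𝟙 (third (final (2 + L)) 0F ≟ j) + (𝟙 (2F ≟ j) + (𝟙 (0F ≟ j) + (𝟙 (third 2F c ≟ j) + r))) ≡
         suc (𝟙 (third (final (2 + L)) c ≟ j) + r)
  peel refl 0F r = +-suc _ r
  peel refl 1F r = +-suc _ r
  peel refl 2F r = +-suc _ r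

-- On a cycle the vertices carrying a given colour are paired by the arcs of that colour, so all
-- three counts have the parity of L. A difference of 2 is therefore unavoidable unless 3 divides L;
-- the pattern confines it to one colour that is ahead or one that is behind. The value d = 1 arises
-- for a single vertex.
data Shape (f : Fin 3 → ℕ) : Set where
  surplus : ∀ c d → d ≤ 2 → (∀ j → f j ≡ c + d * 𝟙 (j ≟ 2F)) → Shape f
  deficit : ∀ c → (∀ j → f j + 2 * 𝟙 (j ≟ 1F) ≡ c + 2) → Shape f

shape : ∀ L → Shape (spares L)
shape 0 = surplus 0 0 z≤n λ _ → refl
shape 1 = surplus 0 1 (s≤s z≤n) λ { 0F → refl ; 1F → refl ; 2F → refl }
shape 2 = surplus 0 2 ≤-refl λ { 0F → refl ; 1F → refl ; 2F → refl }
shape 3 = surplus 1 0 z≤n λ { 0F → refl ; 1F → refl ; 2F → refl }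
shape 4 = deficit 0 λ { 0F → refl ; 1F → refl ; 2F → refl }
shape (suc (suc (suc (suc (suc L))))) with shape (suc (suc L))
... | surplus c d d≤2 eq = surplus (suc c) d d≤2 λ j → trans (spares-+3 L j) (cong suc (eq j))
... | deficit c eq = deficit (suc c) λ j → trans (cong (_+ 2 * 𝟙 (j ≟ 1F)) (spares-+3 L j)) (cong suc (eq j))

-- Balancing the missing colours by rotating each chain

succ₃ : Fin 3 → Fin 3
succ₃ 0F = 1F
succ₃ 1F = 2F
succ₃ 2F = 0F

rotate : Fin 3 → Fin 3 → Fin 3
rotate 0F = id
rotate 1F = succ₃
rotate 2F = succ₃ ∘ succ₃

opposite : Fin 3 → Fin 3
opposite 0F = 0F
opposite 1F = 2F
opposite 2F = 1F

rotate-opposite : ∀ r c → rotate r (rotate (opposite r) c) ≡ c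
rotate-opposite = from-yes (all? λ r → all? λ c → rotate r (rotate (opposite r) c) ≟ c)

opposite-rotate : ∀ r c → rotate (opposite r) (rotate r c) ≡ c
opposite-rotate = from-yes (all? λ r → all? λ c → rotate (opposite r) (rotate r c) ≟ c)

rotate-injective : ∀ r {c d} → rotate r c ≡ rotate r d → c ≡ d
rotate-injective r {c} {d} q = trans (sym (opposite-rotate r c)) (trans (cong (rotate (opposite r)) q) (opposite-rotate r d))

rotation-to : ∀ c d → ∃[ r ] rotate r c ≡ d
rotation-to = from-yes (all? λ c → all? λ d → any? λ r → rotate r c ≟ d)

rotated : ℕ → Fin 3 → Fin 3 → ℕ
rotated L r j = sum {L} (λ p → 𝟙 (rotate r (spare L (toℕ p)) ≟ j))

rotated-spares : ∀ L r j → rotated L r j ≡ spares L (rotate (opposite r) j)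
rotated-spares L r j = sum-cong-≗ {L} λ p → 𝟙-cong (rotate r (spare L (toℕ p)) ≟ j) (spare L (toℕ p) ≟ rotate (opposite r) j)
  (λ q → trans (sym (opposite-rotate r (spare L (toℕ p)))) (cong (rotate (opposite r)) q))
  (λ q → trans (cong (rotate r) q) (rotate-opposite r j))

rotated-target : ∀ r {c t} j → rotate r c ≡ t → 𝟙 (rotate (opposite r) j ≟ c) ≡ 𝟙 (j ≟ t)
rotated-target r {c} {t} j q = 𝟙-cong (rotate (opposite r) j ≟ c) (j ≟ t)
  (λ p → trans (sym (rotate-opposite r j)) (trans (cong (rotate r) p) q))
  (λ p → trans (cong (rotate (opposite r)) (trans p (sym q))) (opposite-rotate r c))

argmin : ∀ {n} (s : Fin (suc n) → ℕ) → ∃[ t ] (∀ j → s t ≤ s j)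
argmin {zero}  s = zero , λ { zero → ≤-refl }
argmin {suc n} s with argmin (s ∘ suc)
... | t , min with ≤-total (s zero) (s (suc t))
...   | inj₁ le = zero , λ { zero → ≤-refl ; (suc j) → ≤-trans le (min j) }
...   | inj₂ ge = suc t , λ { zero → ge ; (suc j) → min j }

argmax : ∀ {n} (s : Fin (suc n) → ℕ) → ∃[ t ] (∀ j → s j ≤ s t)
argmax {zero}  s = zero , λ { zero → ≤-refl }
argmax {suc n} s with argmax (s ∘ suc)
... | t , max with ≤-total (s (suc t)) (s zero)
...   | inj₁ le = zero , λ { zero → ≤-refl ; (suc j) → ≤-trans (max j) le }
...   | inj₂ ge = suc t , λ { zero → ge ; (suc j) → max j }

Spread≤2 : (Fin 3 → ℕ) → Set
Spread≤2 s = ∀ i j → s i ≤ s j + 2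

spread-surplus : ∀ {s f : Fin 3 → ℕ} {t} c d → d ≤ 2 → (∀ j → s t ≤ s j) → (∀ j → f j ≡ c + d * 𝟙 (j ≟ t)) →
                 Spread≤2 s → Spread≤2 (λ j → f j + s j)
spread-surplus {s} {f} {t} c d d≤2 min eq spread i j = begin
  f i + s i        ≤⟨ bound (i ≟ t) ⟩
  c + (s j + 2)    ≡⟨ +-assoc c (s j) 2 ⟨
  c + s j + 2      ≤⟨ +-monoˡ-≤ 2 (+-monoˡ-≤ (s j) (≤-trans (m≤m+n c _) (≤-reflexive (sym (eq j))))) ⟩
  f j + s j + 2    ∎
  where
  open ≤-Reasoning
  bound : Dec (i ≡ t) → f i + s i ≤ c + (s j + 2)
  bound (yes refl) = begin
    f i + s i                      ≡⟨ cong (_+ s i) (trans (eq i) (cong (λ z → c + d * z) (𝟙-yes (i ≟ i) refl))) ⟩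
    c + d * 1 + s i                ≡⟨ trans (cong (λ z → c + z + s i) (*-identityʳ d)) (+-assoc c d (s i)) ⟩
    c + (d + s i)                  ≤⟨ +-monoʳ-≤ c (+-mono-≤ d≤2 (min j)) ⟩
    c + (2 + s j)                  ≡⟨ cong (c +_) (+-comm 2 (s j)) ⟩
    c + (s j + 2)                  ∎
  bound (no i≢t) = begin
    f i + s i                      ≡⟨ cong (_+ s i) (trans (eq i) (cong (λ z → c + d * z) (𝟙-no (i ≟ t) i≢t))) ⟩
    c + d * 0 + s i                ≡⟨ cong (_+ s i) (trans (cong (c +_) (*-zeroʳ d)) (+-identityʳ c)) ⟩
    c + s i                        ≤⟨ +-monoʳ-≤ c (spread i j) ⟩
    c + (s j + 2)                  ∎

spread-deficit : ∀ {s f : Fin 3 → ℕ} {t} c → (∀ j → s j ≤ s t) → (∀ j → f j + 2 * 𝟙 (j ≟ t) ≡ c + 2) →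
                 Spread≤2 s → Spread≤2 (λ j → f j + s j)
spread-deficit {s} {f} {t} c max eq spread i j = bound (i ≟ t) (j ≟ t)
  where
  open ≤-Reasoning
  at-t : ∀ {i} → i ≡ t → f i ≡ c
  at-t {i} refl = +-cancelʳ-≡ 2 (f i) c (trans (cong (λ z → f i + 2 * z) (sym (𝟙-yes (i ≟ i) refl))) (eq i))
  off-t : ∀ {i} → i ≢ t → f i ≡ c + 2
  off-t {i} i≢t = trans (sym (+-identityʳ (f i))) (trans (cong (λ z → f i + 2 * z) (sym (𝟙-no (i ≟ t) i≢t))) (eq i))
  c≤f : c ≤ f j
  c≤f with j ≟ t
  ... | yes q = ≤-reflexive (sym (at-t q))
  ... | no ¬q = ≤-trans (m≤m+n c 2) (≤-reflexive (sym (off-t ¬q)))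
  bound : Dec (i ≡ t) → Dec (j ≡ t) → f i + s i ≤ f j + s j + 2
  bound (yes q) _ = begin
    f i + s i        ≡⟨ cong (_+ s i) (at-t q) ⟩
    c + s i          ≤⟨ +-mono-≤ c≤f (spread i j) ⟩
    f j + (s j + 2)  ≡⟨ +-assoc (f j) (s j) 2 ⟨
    f j + s j + 2    ∎
  bound (no ¬q) (yes r) = begin
    f i + s i        ≡⟨ cong (_+ s i) (off-t ¬q) ⟩
    c + 2 + s i      ≡⟨ cong (λ z → z + 2 + s i) (at-t r) ⟨
    f j + 2 + s i    ≤⟨ +-monoʳ-≤ (f j + 2) (subst (λ z → s i ≤ s z) (sym r) (max i)) ⟩
    f j + 2 + s j    ≡⟨ +-assoc (f j) 2 (s j) ⟩
    f j + (2 + s j)  ≡⟨ cong (f j +_) (+-comm 2 (s j)) ⟩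
    f j + (s j + 2)  ≡⟨ +-assoc (f j) (s j) 2 ⟨
    f j + s j + 2    ∎
  bound (no ¬q) (no ¬r) = begin
    f i + s i        ≡⟨ cong (_+ s i) (trans (off-t ¬q) (sym (off-t ¬r))) ⟩
    f j + s i        ≤⟨ +-monoʳ-≤ (f j) (spread i j) ⟩
    f j + (s j + 2)  ≡⟨ +-assoc (f j) (s j) 2 ⟨
    f j + s j + 2    ∎

BalancedRotations : ∀ {n} → (Fin n → ℕ) → Set
BalancedRotations {n} len = Σ (Fin n → Fin 3) λ r → Spread≤2 (λ j → sum (λ x → rotated (len x) (r x) j))

-- Greedy: the colours of a chain can be permuted cyclically without affecting the others. A surplus
-- is turned onto the colour missing least often so far, a deficit onto the one missing most often,
-- and neither lets the spread exceed 2.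
balanced-rotations : ∀ {n} (len : Fin n → ℕ) → BalancedRotations len
balanced-rotations {zero}  len = (λ ()) , λ _ _ → z≤n
balanced-rotations {suc n} len with balanced-rotations (len ∘ suc)
... | r , spread = choose (shape (len zero))
  where
  s : Fin 3 → ℕ
  s j = sum (λ x → rotated (len (suc x)) (r x) j)
  choose : Shape (spares (len zero)) → BalancedRotations len
  choose (surplus c d d≤2 eq) = (r₀ ◂ r) , spread-surplus {s} {rotated (len zero) r₀} {t} c d d≤2 min eq′ spread
    where
    t = proj₁ (argmin s)
    min = proj₂ (argmin s)
    r₀ = proj₁ (rotation-to 2F t)
    eq′ : ∀ j → rotated (len zero) r₀ j ≡ c + d * 𝟙 (j ≟ t)
    eq′ j = trans (rotated-spares (len zero) r₀ j) (trans (eq (rotate (opposite r₀) j))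
              (cong (λ z → c + d * z) (rotated-target r₀ j (proj₂ (rotation-to 2F t)))))
  choose (deficit c eq) = (r₀ ◂ r) , spread-deficit {s} {rotated (len zero) r₀} {t} c max eq′ spread
    where
    t = proj₁ (argmax s)
    max = proj₂ (argmax s)
    r₀ = proj₁ (rotation-to 1F t)
    eq′ : ∀ j → rotated (len zero) r₀ j + 2 * 𝟙 (j ≟ t) ≡ c + 2
    eq′ j = trans (cong₂ (λ y z → y + 2 * z) (rotated-spares (len zero) r₀ j) (sym (rotated-target r₀ j (proj₂ (rotation-to 1F t)))))
                  (eq (rotate (opposite r₀) j))

-- Colour reservations at the vertices of a factor

-- Of the three colours, port true x is reserved for the arc leaving x, port false x for the arc
-- entering x, and slot x for neither.
record Ports {n} {S : Pred (Fin n) 0ℓ} (S? : Decidable S) {m} (F : Pred (Fin m) 0ℓ) (e : Fin m → Bool → Fin n) : Set where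
  field
    port     : Bool → Fin n → Fin 3
    slot     : Fin n → Fin 3
    port≢    : ∀ {x} → S x → port true x ≢ port false x
    slot≢    : ∀ {x} → S x → ∀ b → slot x ≢ port b x
    arc      : ∀ {i} → F i → port true (e i true) ≡ port false (e i false)
    balanced : ∀ j → count S? ≤ 3 * (count (λ x → S? x ×-dec (j ≟ slot x)) + 2)

-- Open chains are coloured as if they were cycles; the colours reserved for absent arcs at their
-- ends merely stay idle.
ports : ∀ {n} {S : Pred (Fin n) 0ℓ} (S? : Decidable S) {m} {F : Pred (Fin m) 0ℓ} (e : Fin m → Bool → Fin n) →
        (∀ {i} b → F i → S (e i b)) → (∀ {i} → F i → e i true ≢ e i false) → Chains S? F e → Ports S? F e
ports {n} {S} S? {m} {F} e S-ends loopless chains = colour (balanced-rotations len)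
  where
  open Chains chains
  colour : BalancedRotations len → Ports S? F e
  colour (r , spread) = record
    { port = λ { true → tail ; false → head }
    ; slot = slot
    ; port≢ = λ {x} s q → inn≢out _ _ (pos<len s) (sym (rotate-injective (r (comp x)) q))
    ; slot≢ = λ { {x} s true q  → proj₂ (distinct s) (rotate-injective (r (comp x)) q)
                ; {x} s false q → proj₁ (distinct s) (rotate-injective (r (comp x)) q) }
    ; arc = arc
    ; balanced = balanced
    }
    where
    tail head slot : Fin n → Fin 3
    tail x = rotate (r (comp x)) (out (len (comp x)) (pos x))
    head x = rotate (r (comp x)) (inn (len (comp x)) (pos x))
    slot x = rotate (r (comp x)) (spare (len (comp x)) (pos x))

    distinct : ∀ {x} → S x → spare (len (comp x)) (pos x) ≢ inn (len (comp x)) (pos x)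
                           × spare (len (comp x)) (pos x) ≢ out (len (comp x)) (pos x)
    distinct s = third-distinct _ _ (inn≢out _ _ (pos<len s))

    closing : ∀ {l p} → 1 < l → suc p ≡ l → out l p ≡ final l
    closing {suc (suc l)} {suc p} _ refl = out-final p
    closing {suc zero} (s≤s ()) _
    closing {suc (suc l)} {zero} _ ()

    arc : ∀ {i} → F i → tail (e i true) ≡ head (e i false)
    arc {i} f = cong₂ rotate (cong r (same f)) colours
      where
      u = e i true
      v = e i false
      colours : out (len (comp u)) (pos u) ≡ inn (len (comp v)) (pos v)
      colours with next f
      ... | inj₁ q = trans (cong (λ x → out (len x) (pos u)) (same f)) (sym (cong (inn (len (comp v))) q))
      ... | inj₂ (l , z) = trans (closing (≤-trans 1<l (≤-reflexive l)) l)
                             (trans (cong (final ∘ len) (same f)) (sym (cong (inn (len (comp v))) z)))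
        where
        1<l : 1 < suc (pos u)
        1<l with pos u in pu
        ... | suc _ = s≤s (s≤s z≤n)
        -- A closed chain with one vertex would be a loop; this excludes the length at which `final`
        -- is not the colour of the last position.
        ... | zero  = contradiction (pos-injective (S-ends true f) (S-ends false f) (same f) (trans pu (sym z))) (loopless f)

    slots : ∀ j → count (λ x → S? x ×-dec (j ≟ slot x)) ≡ sum (λ x → rotated (len x) (r x) j)
    slots j = begin
      count (λ y → S? y ×-dec (j ≟ slot y))
        ≡⟨ count-fibres (λ y → S? y ×-dec (j ≟ slot y)) comp ⟩
      sum (λ x → count (λ y → (x ≟ comp y) ×-dec (S? y ×-dec (j ≟ slot y))))
        ≡⟨ sum-cong-≗ (λ x → sum-cong-≗ (λ y → trans (𝟙-cong _ ((S? y ×-dec (comp y ≟ x)) ×-dec colour? x (pos y))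
             (λ { (refl , s , q) → (s , refl) , sym q }) (λ { ((s , refl) , q) → refl , s , sym q }))
             (𝟙-× (S? y ×-dec (comp y ≟ x)) (colour? x (pos y))))) ⟩
      sum (λ x → sum (λ y → 𝟙 (S? y ×-dec (comp y ≟ x)) * 𝟙 (colour? x (pos y))))
        -- Slot colours depend only on the position in the chain, so the tally replaces the vertices
        -- of each chain by its positions.
        ≡⟨ sum-cong-≗ (λ x → tally x (λ p → 𝟙 (colour? x p))) ⟩
      sum (λ x → rotated (len x) (r x) j) ∎
      where
      open ≡-Reasoning
      colour? = λ x p → rotate (r x) (spare (len x) p) ≟ j

    balanced : ∀ j → count S? ≤ 3 * (count (λ x → S? x ×-dec (j ≟ slot x)) + 2)
    balanced j = begin
      count S? ≡⟨ count-fibres S? slot ⟩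
      sum (λ i → count (λ x → (i ≟ slot x) ×-dec S? x))
        ≡⟨ sum-cong-≗ {3} (λ i → count-cong (λ x → (i ≟ slot x) ×-dec S? x) (λ x → S? x ×-dec (i ≟ slot x))
             (λ (p , q) → q , p) (λ (p , q) → q , p)) ⟩
      sum σ ≤⟨ sum-≤-const (σ j + 2) (λ i → le i j) ⟩
      3 * (σ j + 2) ∎
      where
      open ≤-Reasoning
      σ : Fin 3 → ℕ
      σ i = count (λ x → S? x ×-dec (i ≟ slot x))
      le : ∀ i j → σ i ≤ σ j + 2
      le i j = subst₂ (λ a b → a ≤ b + 2) (sym (slots i)) (sym (slots j)) (spread i j)

-- Demands and realizations

-- A demand has the ends e i true and e i false, and is finished (a loop) once they coincide.
module _ {m n : ℕ} where

  Active : (Fin m → Bool → Fin n) → Pred (Fin m) 0ℓ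
  Active e i = e i true ≢ e i false

  active? : ∀ e → Decidable (Active e)
  active? e i = ¬? (e i true ≟ e i false)

  incidence : (Fin m → Bool → Fin n) → Bool → Fin n → ℕ
  incidence e b x = count (at? (active? e) e b x)

  -- Own x y i says that the i-th demand is routed along the edge xy.
  record Realization (S : Pred (Fin n) 0ℓ) (e : Fin m → Bool → Fin n) : Set₁ where
    field
      Own        : Fin n → Fin n → Fin m → Set
      own-sym    : ∀ {x y i} → Own x y i → Own y x i
      own-irrefl : ∀ {x y i} → Own x y i → x ≢ y
      own-S      : ∀ {x y i} → Own x y i → S x
      own-unique : ∀ {x y i j} → Own x y i → Own x y j → i ≡ j
      connected  : ∀ i → Star (λ x y → Own x y i) (e i true) (e i false)

  active-ends : ∀ {e i} → Active e i → ∀ b → e i b ≢ e i (not b)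
  active-ends a true  = a
  active-ends a false = a ∘ sym

-- Spokes to three centres

-- Spoke x j i says that demand i uses the edge from x to the centre a j. Since the ports of a j have
-- the colours j and succ₃ (succ₃ j), no edge between two centres is used from both of its ends.
module Centres {m n} {S : Pred (Fin n) 0ℓ} {S? : Decidable S} {F : Pred (Fin m) 0ℓ} {e : Fin m → Bool → Fin n}
               (F-S : ∀ {i} b → F i → S (e i b)) (proper : ∀ {i j} b → F i → F j → e i b ≡ e j b → i ≡ j)
               (P : Ports S? F e) (a : Fin 3 → Fin n)
               (a-S : ∀ j → S (a j)) (a-slot : ∀ j → succ₃ j ≡ Ports.slot P (a j)) where
  open Ports P

  a-injective : ∀ {j l} → a j ≡ a l → j ≡ l
  a-injective {j} {l} q = rotate-injective 1F (trans (a-slot j) (trans (cong slot q) (sym (a-slot l))))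

  Spoke : Fin n → Fin 3 → Fin m → Set
  Spoke x j i = F i × x ≢ a j × ∃[ b ] (e i b ≡ x × port b x ≡ j)

  spoke-S : ∀ {x j i} → Spoke x j i → S x
  spoke-S (f , _ , b , refl , _) = F-S b f

  port-injective : ∀ {x} → S x → ∀ {b c} → port b x ≡ port c x → b ≡ c
  port-injective s {true}  {true}  q = refl
  port-injective s {true}  {false} q = contradiction q (port≢ s)
  port-injective s {false} {true}  q = contradiction (sym q) (port≢ s)
  port-injective s {false} {false} q = refl

  spoke-unique : ∀ {x j i i′} → Spoke x j i → Spoke x j i′ → i ≡ i′
  spoke-unique {x} (f , _ , b , q , p) (f′ , _ , b′ , q′ , p′) with port-injective (subst S q (F-S b f)) {b} {b′} (trans p (sym p′))
  ... | refl = proper b f f′ (trans q (sym q′))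

  spoke-slot : ∀ {x j i} → Spoke x j i → slot x ≢ j
  spoke-slot sp@(_ , _ , b , _ , p) q = slot≢ (spoke-S sp) b (trans q (sym p))

  -- Of two distinct elements of `Fin 3` one is the successor of the other, and a centre has no port
  -- whose colour is the successor of its own.
  spoke-cross : ∀ {j l i i′} → Spoke (a l) j i → ¬ Spoke (a j) l i′
  spoke-cross {j} {l} sp sp′ = impossible j l (λ { refl → proj₁ (proj₂ sp) refl })
    (λ q → spoke-slot sp (trans (sym (a-slot l)) q)) (λ q → spoke-slot sp′ (trans (sym (a-slot j)) q))
    where
    impossible : ∀ j l → j ≢ l → succ₃ l ≢ j → succ₃ j ≢ l → ⊥
    impossible 0F 0F p _ _ = p refl
    impossible 0F 1F _ _ p = p refl
    impossible 0F 2F _ p _ = p refl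
    impossible 1F 0F _ p _ = p refl
    impossible 1F 1F p _ _ = p refl
    impossible 1F 2F _ _ p = p refl
    impossible 2F 0F _ _ p = p refl
    impossible 2F 1F _ p _ = p refl
    impossible 2F 2F p _ _ = p refl

  arc-port : ∀ {i} → F i → ∀ b → port b (e i b) ≡ port (not b) (e i (not b))
  arc-port f true  = arc f
  arc-port f false = sym (arc f)

-- Routing a single factor

module OneFactor {m n} {S : Pred (Fin n) 0ℓ} {S? : Decidable S} {e : Fin m → Bool → Fin n}
                 (S-ends : ∀ {i} b → Active e i → S (e i b))
                 (proper : ∀ {i j} b → Active e i → Active e j → e i b ≡ e j b → i ≡ j)
                 (P : Ports S? (Active e) e) (a : Fin 3 → Fin n)
                 (a-S : ∀ j → S (a j)) (a-slot : ∀ j → succ₃ j ≡ Ports.slot P (a j)) where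
  open Ports P
  open Centres S-ends proper P a a-S a-slot

  Step : Fin n → Fin n → Fin m → Set
  Step x y i = ∃[ j ] (x ≡ a j × Spoke y j i)

  Own : Fin n → Fin n → Fin m → Set
  Own x y i = Step x y i ⊎ Step y x i

  step-unique : ∀ {x y i j} → Step x y i → Step x y j → i ≡ j
  step-unique (j , q , sp) (j′ , q′ , sp′) with a-injective (trans (sym q) q′)
  ... | refl = spoke-unique sp sp′

  step-antisym : ∀ {x y i j} → Step x y i → ¬ Step y x j
  step-antisym (j , refl , sp) (l , refl , sp′) = spoke-cross sp sp′

  own-sym : ∀ {x y i} → Own x y i → Own y x i
  own-sym = [ inj₂ , inj₁ ]′

  to-centre : ∀ {i} → Active e i → ∀ b → Star (λ x y → Own x y i) (e i b) (a (port b (e i b)))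
  to-centre {i} f b with e i b ≟ a (port b (e i b))
  ... | yes q = subst (Star _ (e i b)) q ε
  ... | no ¬q = return (inj₂ (_ , refl , f , ¬q , b , refl , refl))

  -- With a single factor both halves of every demand meet at the centre of its colour, so nothing
  -- has to be handed over.
  realization : Realization S e
  realization = record
    { Own = Own
    ; own-sym = own-sym
    ; own-irrefl = λ { (inj₁ (j , refl , sp)) q → proj₁ (proj₂ sp) (sym q) ; (inj₂ (j , refl , sp)) q → proj₁ (proj₂ sp) q }
    ; own-S = λ { (inj₁ (j , refl , sp)) → a-S j ; (inj₂ (j , refl , sp)) → spoke-S sp }
    ; own-unique = λ { (inj₁ s) (inj₁ s′) → step-unique s s′ ; (inj₂ s) (inj₂ s′) → step-unique s s′
                     ; (inj₁ s) (inj₂ s′) → contradiction s′ (step-antisym s)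
                     ; (inj₂ s) (inj₁ s′) → contradiction s (step-antisym s′) }
    ; connected = λ i → connect i (active? e i)
    }
    where
    connect : ∀ i → Dec (Active e i) → Star (λ x y → Own x y i) (e i true) (e i false)
    connect i (yes f) = to-centre f true ◅◅ subst (λ c → Star (λ x y → Own x y i) (a c) (e i false)) (sym (arc f)) (reverse own-sym (to-centre f false))
    connect i (no ¬f) with e i true ≟ e i false
    ... | yes q = subst (Star _ (e i true)) q ε
    ... | no ¬q = contradiction ¬q ¬f

-- Routing two factors and handing over what remains

record Centred {n m} {S : Pred (Fin n) 0ℓ} {S? : Decidable S} {F : Pred (Fin m) 0ℓ} {e : Fin m → Bool → Fin n}
               (P : Ports S? F e) : Set where
  field
    centre      : Fin 3 → Fin n
    centre-S    : ∀ j → S (centre j)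
    centre-slot : ∀ j → succ₃ j ≡ Ports.slot P (centre j)

module TwoFactorStep {m n k : ℕ} {S : Pred (Fin n) 0ℓ} (S? : Decidable S) (e : Fin m → Bool → Fin n)
                     (S-ends : ∀ {i} b → Active e i → S (e i b))
                     (two : TwoFactors (active? e) e k)
                     (P : ∀ f → Ports S? (λ i → TwoFactors.class two i ≡ just f) e)
                     (C : ∀ f → Centred (P f))
                     (centres-apart : ∀ j l → Centred.centre (C true) j ≢ Centred.centre (C false) l)
                     (large : 6 * (2 + k) + 12 ≤ count S?) where
  open TwoFactors two

  a : Bool → Fin 3 → Fin n
  a f = Centred.centre (C f)

  port : Bool → Bool → Fin n → Fin 3
  port f = Ports.port (P f)

  slot : Bool → Fin n → Fin 3
  slot f = Ports.slot (P f)

  module Centre (f : Bool) = Centres (λ b c → S-ends b (class-active c)) class-proper (P f)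
                               (a f) (Centred.centre-S (C f)) (Centred.centre-slot (C f))
  open Centre using (Spoke)

  a-S : ∀ f j → S (a f j)
  a-S f = Centred.centre-S (C f)

  a-apart : ∀ {f g j l} → f ≢ g → a f j ≢ a g l
  a-apart {true}  {true}  f≢g = contradiction refl f≢g
  a-apart {true}  {false} f≢g = centres-apart _ _
  a-apart {false} {true}  f≢g = centres-apart _ _ ∘ sym
  a-apart {false} {false} f≢g = contradiction refl f≢g

  a-injective : ∀ {f g j l} → a f j ≡ a g l → f ≡ g × j ≡ l
  a-injective {f} {g} {j} {l} q with f Bool.≟ g
  ... | yes refl = refl , Centre.a-injective f q
  ... | no f≢g   = contradiction q (a-apart f≢g)

  Centre∋ : Pred (Fin n) 0ℓ
  Centre∋ x = ∃[ f ] ∃[ j ] x ≡ a f j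

  centre? : Decidable Centre∋
  centre? x with ∈image? (a true) x | ∈image? (a false) x
  ... | yes q | _     = yes (true , q)
  ... | no  _ | yes q = yes (false , q)
  ... | no ¬t | no ¬f = no λ { (true , q) → ¬t q ; (false , q) → ¬f q }

  S⁻ : Pred (Fin n) 0ℓ
  S⁻ x = S x × ¬ Centre∋ x

  S⁻? : Decidable S⁻
  S⁻? x = S? x ×-dec ¬? (centre? x)

  -- A half of a demand of the factor f moves along its own edge to the centre given by its colour,
  -- unless it lies at a centre of the other factor.
  Foreign : Bool → Pred (Fin n) 0ℓ
  Foreign f x = ∃[ l ] x ≡ a (not f) l

  foreign? : ∀ f → Decidable (Foreign f)
  foreign? f = ∈image? (a (not f))

  dest : Bool → Bool → Fin n → Fin n
  dest f b x with foreign? f x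
  ... | yes _ = x
  ... | no _  = a f (port f b x)

  dest-foreign : ∀ {f b x} → Foreign f x → dest f b x ≡ x
  dest-foreign {f} {b} {x} q with foreign? f x
  ... | yes _ = refl
  ... | no ¬q = contradiction q ¬q

  dest-own : ∀ {f b x} → ¬ Foreign f x → dest f b x ≡ a f (port f b x)
  dest-own {f} {b} {x} ¬q with foreign? f x
  ... | yes q = contradiction q ¬q
  ... | no _  = refl

  place : Maybe Bool → Bool → Fin n → Fin n
  place (just f) b x = dest f b x
  place nothing  b x = x

  e₁ : Fin m → Bool → Fin n
  e₁ i b = place (class i) b (e i b)

  e₁-factor : ∀ {i f} b → class i ≡ just f → e₁ i b ≡ dest f b (e i b)
  e₁-factor {i} b c = cong (λ t → place t b (e i b)) c

  e₁-rest : ∀ {i} b → class i ≡ nothing → e₁ i b ≡ e i b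
  e₁-rest {i} b c = cong (λ t → place t b (e i b)) c

  e₁-own : ∀ {i f} b → class i ≡ just f → ¬ Foreign f (e i b) → e₁ i b ≡ a f (port f b (e i b))
  e₁-own b c ¬q = trans (e₁-factor b c) (dest-own ¬q)

  e₁-foreign : ∀ {i f} b → class i ≡ just f → Foreign f (e i b) → e₁ i b ≡ e i b
  e₁-foreign b c q = trans (e₁-factor b c) (dest-foreign q)

  factor-centre : ∀ {i f} b → class i ≡ just f → Centre∋ (e₁ i b)
  factor-centre {i} {f} b c = go (foreign? f (e i b))
    where
    go : Dec (Foreign f (e i b)) → Centre∋ (e₁ i b)
    go (yes (l , q)) = not f , l , trans (e₁-foreign b c (l , q)) q
    go (no ¬q)       = f , _ , e₁-own b c ¬q

  class-cases : ∀ i → (∃[ f ] class i ≡ just f) ⊎ class i ≡ nothing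
  class-cases i with class i
  ... | just f  = inj₁ (f , refl)
  ... | nothing = inj₂ refl

  rest-active : ∀ {i} → Active e₁ i → class i ≡ nothing → Active e i
  rest-active act c q = act (trans (e₁-rest true c) (trans q (sym (e₁-rest false c))))

  -- These halves have to leave, whether they just arrived or lay there from the start, because the
  -- centres are deleted before the recursion.
  Need : Bool → Fin 3 → Bool → Pred (Fin m) 0ℓ
  Need f j b i = Active e₁ i × e₁ i b ≡ a f j

  need? : ∀ f j b → Decidable (Need f j b)
  need? f j b i = active? e₁ i ×-dec (e₁ i b ≟ a f j)

  Rest : Pred (Fin m) 0ℓ
  Rest i = Active e i × class i ≡ nothing

  rest? : Decidable Rest
  rest? i = active? e i ×-dec (class i ≟ᴹ nothing)

  -- The edge from such a vertex to `a f j` carries no spoke, as j is neither of its ports in the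
  -- factor f.
  Target : Bool → Fin 3 → Pred (Fin n) 0ℓ
  Target f j x = S⁻ x × j ≡ slot f x

  target? : ∀ f j → Decidable (Target f j)
  target? f j x = S⁻? x ×-dec (j ≟ slot f x)

  module Capacity (f : Bool) (j : Fin 3) where

    g : Bool
    g = not f

    -- A half of the factor f that has moved to a f j belongs to an unfinished demand only if the
    -- other half is held back at a centre of the other factor.
    Crossing : Bool → Fin 3 → Pred (Fin m) 0ℓ
    Crossing b l i = class i ≡ just f × e i (not b) ≡ a g l × port f (not b) (a g l) ≡ j

    crossing? : ∀ b l → Decidable (Crossing b l)
    crossing? b l i = (class i ≟ᴹ just f) ×-dec (e i (not b) ≟ a g l) ×-dec (port f (not b) (a g l) ≟ j)

    other? : ∀ b → Decidable (λ i → class i ≡ just g × e i b ≡ a f j)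
    other? b i = (class i ≟ᴹ just g) ×-dec (e i b ≟ a f j)

    -- A demand of the factor f with both halves free to move is absent: they meet at the centre of
    -- its colour, which finishes it. A half of the other factor can only be one that was held back
    -- here.
    need-cases : ∀ {b i} → Need f j b i → (Rest i × e i b ≡ a f j) ⊎ ((class i ≡ just g × e i b ≡ a f j) ⊎ ∃[ l ] Crossing b l i)
    need-cases {b} {i} (act , q) = go (class-cases i)
      where
      Cases = (Rest i × e i b ≡ a f j) ⊎ ((class i ≡ just g × e i b ≡ a f j) ⊎ ∃[ l ] Crossing b l i)
      same : class i ≡ just f → Dec (Foreign f (e i b)) → Dec (Foreign f (e i (not b))) → Cases
      same c (yes (l , r)) _ = contradiction (trans (sym q) (trans (e₁-foreign b c (l , r)) r)) (a-apart (λ p → ≡⇒not-≢ p refl))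
      same c (no ¬r) (yes (l , r)) = inj₂ (inj₂ (l , c , r , (begin
        port f (not b) (a g l)        ≡⟨ cong (port f (not b)) r ⟨
        port f (not b) (e i (not b))  ≡⟨ Centre.arc-port f c b ⟨
        port f b (e i b)              ≡⟨ proj₂ (a-injective (trans (sym (e₁-own b c ¬r)) q)) ⟩
        j                             ∎)))
        where open ≡-Reasoning
      same c (no ¬r) (no ¬r′) = contradiction (trans (e₁-own b c ¬r) (trans (cong (a f) (Centre.arc-port f c b)) (sym (e₁-own (not b) c ¬r′))))
                                              (active-ends {e = e₁} act b)
      different : ∀ {h} → class i ≡ just h → h ≢ f → Dec (Foreign h (e i b)) → Cases
      different {h} c h≢f (yes r) = inj₂ (inj₁ (trans c (cong just (sym (not-≢ (h≢f ∘ sym)))) , trans (sym (e₁-foreign b c r)) q))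
      different {h} c h≢f (no ¬r) = contradiction (trans (sym (e₁-own b c ¬r)) q) (a-apart h≢f)
      go : (∃[ f ] class i ≡ just f) ⊎ class i ≡ nothing → Cases
      go (inj₂ c) = inj₁ ((rest-active act c , c) , trans (sym (e₁-rest b c)) q)
      go (inj₁ (h , c)) with h Bool.≟ f
      ... | yes refl = same c (foreign? f (e i b)) (foreign? f (e i (not b)))
      ... | no h≢f   = different c h≢f (foreign? h (e i b))

    crossings : Bool → ℕ
    crossings b = sum (λ l → 𝟙 (port f b (a g l) ≟ j))

    need-bound : ∀ b → count (need? f j b) ≤ k + (1 + crossings (not b))
    need-bound b = begin
      count (need? f j b)
        ≤⟨ count-cover (need? f j b) (at? rest? e b (a f j)) (λ i → other? b i ⊎-dec any? (λ l → crossing? b l i)) need-cases ⟩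
      count (at? rest? e b (a f j)) + count (λ i → other? b i ⊎-dec any? (λ l → crossing? b l i))
        ≤⟨ +-mono-≤ (rest-degree b (a f j)) (count-cover (λ i → other? b i ⊎-dec any? (λ l → crossing? b l i)) (other? b) (λ i → any? (λ l → crossing? b l i)) id) ⟩
      k + (count (other? b) + count (λ i → any? (λ l → crossing? b l i)))
        ≤⟨ +-monoʳ-≤ k (+-mono-≤ (unique⇒count≤1 (other? b) λ (c , q) (c′ , q′) → class-proper b c c′ (trans q (sym q′)))
             (≤-trans (count-∃ (crossing? b)) (sum-mono crossing-bound))) ⟩
      k + (1 + crossings (not b)) ∎
      where
      open ≤-Reasoning
      crossing-bound : ∀ l → count (crossing? b l) ≤ 𝟙 (port f (not b) (a g l) ≟ j)
      crossing-bound l = go (port f (not b) (a g l) ≟ j)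
        where
        go : (d : Dec (port f (not b) (a g l) ≡ j)) → count (crossing? b l) ≤ 𝟙 d
        go (yes _) = unique⇒count≤1 (crossing? b l) λ (c , q , _) (c′ , q′ , _) → class-proper (not b) c c′ (trans q (sym q′))
        go (no ¬p) = ≤-reflexive (count-none (crossing? b l) λ (_ , _ , p) → ¬p p)

    slot? : Decidable (λ x → S x × j ≡ slot f x)
    slot? x = S? x ×-dec (j ≟ slot f x)

    occupied : ℕ
    occupied = sum (λ l → 𝟙 (j ≟ slot f (a g l)))

    -- Among the centres of its own factor at most one misses j, since they miss the colours
    -- `succ₃ l` and `succ₃` is injective.
    slots-bound : count slot? ≤ count (target? f j) + occupied + 1
    slots-bound = begin
      count slot?
        ≤⟨ count-avoid slot? (a f) ⟩
      count near? + sum (λ l → 𝟙 (slot? (a f l)))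
        ≤⟨ +-mono-≤ (count-avoid near? (a g)) own ⟩
      count (λ x → near? x ×-dec ¬? (∈image? (a g) x)) + sum (λ l → 𝟙 (near? (a g l))) + 1
        ≤⟨ +-monoˡ-≤ 1 (+-mono-≤ (count-mono (λ x → near? x ×-dec ¬? (∈image? (a g) x)) (target? f j) outside)
             (sum-mono (λ l → 𝟙-mono (near? (a g l)) (j ≟ slot f (a g l)) (proj₂ ∘ proj₁)))) ⟩
      count (target? f j) + occupied + 1 ∎
      where
      open ≤-Reasoning
      near? = λ x → slot? x ×-dec ¬? (∈image? (a f) x)
      own : sum (λ l → 𝟙 (slot? (a f l))) ≤ 1
      own = unique⇒count≤1 (λ l → slot? (a f l)) λ {l} {l′} (_ , q) (_ , q′) →
        rotate-injective 1F (trans (Centred.centre-slot (C f) l) (trans (sym q) (trans q′ (sym (Centred.centre-slot (C f) l′)))))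
      outside : ∀ {x} → ((S x × j ≡ slot f x) × ¬ (∃[ l ] x ≡ a f l)) × ¬ (∃[ l ] x ≡ a g l) → Target f j x
      outside {x} (((s , q) , ¬f) , ¬g) = (s , not-centre) , q
        where
        not-centre : ¬ Centre∋ x
        not-centre (h , l , r) with h Bool.≟ f
        ... | yes refl = ¬f (l , r)
        ... | no h≢f   = ¬g (l , trans r (cong (λ h → a h l) (sym (not-≢ (h≢f ∘ sym)))))

    -- At a centre of the other factor, j is at most one of out-port, in-port and slot. Such a
    -- centre thus either holds back a partner of one half at `a f j` or is lost as a target, but
    -- not both.
    three-colours : crossings true + crossings false + occupied ≤ 3
    three-colours = begin
      crossings true + crossings false + occupied
        ≡⟨ cong (_+ occupied) (∑-distrib-+ (λ l → 𝟙 (port f true (a g l) ≟ j)) (λ l → 𝟙 (port f false (a g l) ≟ j))) ⟨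
      sum (λ l → 𝟙 (port f true (a g l) ≟ j) + 𝟙 (port f false (a g l) ≟ j)) + occupied
        ≡⟨ ∑-distrib-+ (λ l → 𝟙 (port f true (a g l) ≟ j) + 𝟙 (port f false (a g l) ≟ j)) (λ l → 𝟙 (j ≟ slot f (a g l))) ⟨
      sum (λ l → 𝟙 (port f true (a g l) ≟ j) + 𝟙 (port f false (a g l) ≟ j) + 𝟙 (j ≟ slot f (a g l)))
        ≤⟨ sum-≤-const {3} 1 (λ l → once (port f true (a g l) ≟ j) (port f false (a g l) ≟ j) (j ≟ slot f (a g l))
             (λ p q → Ports.port≢ (P f) (a-S g l) (trans p (sym q)))
             (λ p q → Ports.slot≢ (P f) (a-S g l) true (sym (trans p q)))
             (λ p q → Ports.slot≢ (P f) (a-S g l) false (sym (trans p q)))) ⟩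
      3 ∎
      where
      open ≤-Reasoning
      once : {X Y Z : Set} (x? : Dec X) (y? : Dec Y) (z? : Dec Z) → (X → ¬ Y) → (X → ¬ Z) → (Y → ¬ Z) → 𝟙 x? + 𝟙 y? + 𝟙 z? ≤ 1
      once (yes x) (yes y) _       xy _ _ = contradiction y (xy x)
      once (yes x) (no _)  (yes z) _ xz _ = contradiction z (xz x)
      once (yes _) (no _)  (no _)  _ _ _  = ≤-refl
      once (no _)  (yes y) (yes z) _ _ yz = contradiction z (yz y)
      once (no _)  (yes _) (no _)  _ _ _  = ≤-refl
      once (no _)  (no _)  z?      _ _ _  = 𝟙≤1 z?

    many-slots : 2 * k + 6 ≤ count slot?
    -- Dividing 6(2 + k) + 12 = 3(2k + 8) by 3 and subtracting the imbalance 2 leaves 2k + 6.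
    many-slots = +-cancelʳ-≤ 2 (2 * k + 6) (count slot?) (*-cancelˡ-≤ 3 (≤-trans (≤-reflexive (rearranged k)) (≤-trans large (Ports.balanced (P f) j))))
      where
      rearranged : ∀ k → 3 * (2 * k + 6 + 2) ≡ 6 * (2 + k) + 12
      rearranged = solve 1 (λ k → con 3 :* (con 2 :* k :+ con 6 :+ con 2) := con 6 :* (con 2 :+ k) :+ con 12) refl
        where open +-*-Solver

    -- The halves to be passed on and the targets lost add up to at most 2k + 2 + 1 + 3, exactly the
    -- number of vertices known to miss j. There is no slack, and this fixes the constant 12 in
    -- `large`.
    fits : count (need? f j true) + count (need? f j false) ≤ count (target? f j)
    fits = +-cancelʳ-≤ (occupied + 1) _ _ (begin
      count (need? f j true) + count (need? f j false) + (occupied + 1)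
        ≤⟨ +-monoˡ-≤ (occupied + 1) (+-mono-≤ (need-bound true) (need-bound false)) ⟩
      k + (1 + crossings false) + (k + (1 + crossings true)) + (occupied + 1)
        ≡⟨ arrange k (crossings true) (crossings false) occupied ⟩
      2 * k + 3 + (crossings true + crossings false + occupied)
        ≤⟨ +-monoʳ-≤ (2 * k + 3) three-colours ⟩
      2 * k + 3 + 3
        ≡⟨ +-assoc (2 * k) 3 3 ⟩
      2 * k + 6
        ≤⟨ many-slots ⟩
      count slot?
        ≤⟨ slots-bound ⟩
      count (target? f j) + occupied + 1
        ≡⟨ +-assoc (count (target? f j)) occupied 1 ⟩
      count (target? f j) + (occupied + 1) ∎)
      where
      open ≤-Reasoning
      arrange : ∀ k x y z → k + (1 + y) + (k + (1 + x)) + (z + 1) ≡ 2 * k + 3 + (x + y + z)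
      arrange = solve 4 (λ k x y z → k :+ (con 1 :+ y) :+ (k :+ (con 1 :+ x)) :+ (z :+ con 1) := con 2 :* k :+ con 3 :+ (x :+ y :+ z)) refl
        where open +-*-Solver

  Transfer : Bool → Fin 3 → Set
  Transfer f j = Σ (Fin m → Bool → Fin n) λ φ → (∀ {i b} → Need f j b i → Target f j (φ i b))
                   × (∀ {i i′ b b′} → Need f j b i → Need f j b′ i′ → φ i b ≡ φ i′ b′ → i ≡ i′ × b ≡ b′)

  abstract
    transfer : ∀ f j → Transfer f j
    transfer f j = inject-halves (need? f j) (target? f j) (a f j) (Capacity.fits f j)

  φ : Bool → Fin 3 → Fin m → Bool → Fin n
  φ f j = proj₁ (transfer f j)

  φ-target : ∀ {f j i b} → Need f j b i → Target f j (φ f j i b)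
  φ-target {f} {j} = proj₁ (proj₂ (transfer f j))

  φ-injective : ∀ {f j i i′ b b′} → Need f j b i → Need f j b′ i′ → φ f j i b ≡ φ f j i′ b′ → i ≡ i′ × b ≡ b′
  φ-injective {f} {j} = proj₂ (proj₂ (transfer f j))

  -- A finished demand may stay at a deleted centre: it is a loop and needs no further route.
  retarget : ∀ i b → Dec (Active e₁ i) → Dec (Centre∋ (e₁ i b)) → Fin n
  retarget i b (yes _) (yes (f , j , _)) = φ f j i b
  retarget i b _       _                 = e₁ i b

  e₂ : Fin m → Bool → Fin n
  e₂ i b = retarget i b (active? e₁ i) (centre? (e₁ i b))

  data Retargeted (i : Fin m) (b : Bool) : Set where
    moved  : ∀ f j → Need f j b i → e₂ i b ≡ φ f j i b → Retargeted i b
    stayed : (Active e₁ i → ¬ Centre∋ (e₁ i b)) → e₂ i b ≡ e₁ i b → Retargeted i b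

  retargeted : ∀ i b → Retargeted i b
  retargeted i b = go (active? e₁ i) (centre? (e₁ i b)) refl
    where
    go : ∀ act? c? → e₂ i b ≡ retarget i b act? c? → Retargeted i b
    go (yes act) (yes (f , j , q)) r = moved f j (act , q) r
    go (yes _)   (no ¬c)           r = stayed (λ _ → ¬c) r
    go (no ¬act) _                 r = stayed (λ act → contradiction act ¬act) r

  e₂-idle : ∀ {i} → ¬ Active e₁ i → ∀ b → e₂ i b ≡ e₁ i b
  e₂-idle {i} ¬act b with retargeted i b
  ... | moved _ _ (act , _) _ = contradiction act ¬act
  ... | stayed _ q            = q

  e₂-active : ∀ {i} → Active e₂ i → Active e₁ i
  e₂-active {i} act q = act (trans (e₂-idle (λ act₁ → act₁ q) true) (trans q (sym (e₂-idle (λ act₁ → act₁ q) false))))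

  stayed-rest : ∀ {i b} → Active e₁ i → ¬ Centre∋ (e₁ i b) → Rest i × e₁ i b ≡ e i b
  stayed-rest {i} {b} act ¬c with class-cases i
  ... | inj₁ (f , c) = contradiction (factor-centre b c) ¬c
  ... | inj₂ c       = (rest-active act c , c) , e₁-rest b c

  e₂-S⁻ : ∀ {i} b → Active e₂ i → S⁻ (e₂ i b)
  e₂-S⁻ {i} b act with retargeted i b
  ... | moved f j need q = subst S⁻ (sym q) (proj₁ (φ-target need))
  ... | stayed ¬c q      = let ((rest , r)) = stayed-rest {i} {b} (e₂-active act) (¬c (e₂-active act))
                           in subst S⁻ (sym (trans q r)) (S-ends b (proj₁ rest) , λ c → ¬c (e₂-active act) (subst Centre∋ (sym r) c))

  Received : Bool → Fin n → Bool → Pred (Fin m) 0ℓ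
  Received f x b i = Need f (slot f x) b i × φ f (slot f x) i b ≡ x

  received? : ∀ f x b → Decidable (Received f x b)
  received? f x b i = need? f (slot f x) b i ×-dec (φ f (slot f x) i b ≟ x)

  -- The factor f can reach x only from the centre of the colour `slot f x`, and the transfer from
  -- that centre is injective on both kinds of halves together.
  received≤1 : ∀ f x → count (received? f x true) + count (received? f x false) ≤ 1
  received≤1 f x = count-halves≤1 (received? f x) λ (need , q) (need′ , q′) → φ-injective need need′ (trans q (sym q′))

  e₂-cases : ∀ {x b i} → Active e₂ i × e₂ i b ≡ x → (Rest i × e i b ≡ x) ⊎ (Received true x b i ⊎ Received false x b i)
  e₂-cases {x} {b} {i} (act , refl) with retargeted i b
  ... | stayed ¬c q = let (rest , r) = stayed-rest {i} {b} (e₂-active act) (¬c (e₂-active act)) in inj₁ (rest , sym (trans q r))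
  ... | moved f j need q = inj₂ (receive f (received j need q))
    where
    received : ∀ j → Need f j b i → e₂ i b ≡ φ f j i b → Received f (e₂ i b) b i
    received j need q with trans (proj₂ (φ-target need)) (cong (slot f) (sym q))
    ... | refl = need , sym q
    receive : ∀ f → Received f (e₂ i b) b i → Received true (e₂ i b) b i ⊎ Received false (e₂ i b) b i
    receive true  = inj₁
    receive false = inj₂

  e₂-incidence : ∀ b x → incidence e₂ b x ≤ k + (count (received? true x b) + count (received? false x b))
  e₂-incidence b x = ≤-trans
    (count-cover (at? (active? e₂) e₂ b x) (at? rest? e b x) (λ i → received? true x b i ⊎-dec received? false x b i) e₂-cases)
    (+-mono-≤ (rest-degree b x)
      (count-cover (λ i → received? true x b i ⊎-dec received? false x b i) (received? true x b) (received? false x b) id))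

  -- The two received halves may be of the same kind, so only the sum of the two incidences is
  -- bounded by 2(1 + k). This is why each round orients the demands afresh.
  e₂-degree : ∀ x → incidence e₂ true x + incidence e₂ false x ≤ 2 * (1 + k)
  e₂-degree x = begin
    incidence e₂ true x + incidence e₂ false x ≤⟨ +-mono-≤ (e₂-incidence true x) (e₂-incidence false x) ⟩
    k + (r true true + r false true) + (k + (r true false + r false false))
      ≡⟨ arrange k (r true true) (r false true) (r true false) (r false false) ⟩
    2 * k + ((r true true + r true false) + (r false true + r false false))
      ≤⟨ +-monoʳ-≤ (2 * k) (+-mono-≤ (received≤1 true x) (received≤1 false x)) ⟩
    2 * k + 2 ≡⟨ trans (+-comm (2 * k) 2) (sym (*-distribˡ-+ 2 1 k)) ⟩
    2 * (1 + k) ∎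
    where
    open ≤-Reasoning
    r : Bool → Bool → ℕ
    r f b = count (received? f x b)
    arrange : ∀ k x y z w → k + (x + y) + (k + (z + w)) ≡ 2 * k + ((x + z) + (y + w))
    arrange = solve 5 (λ k x y z w → k :+ (x :+ y) :+ (k :+ (z :+ w)) := con 2 :* k :+ ((x :+ z) :+ (y :+ w))) refl
      where open +-*-Solver

  S⁻-large : 6 * (1 + k) + 12 ≤ count S⁻?
  S⁻-large = +-cancelʳ-≤ 6 (6 * (1 + k) + 12) (count S⁻?) (begin
    6 * (1 + k) + 12 + 6 ≡⟨ arrange k ⟩
    6 * (2 + k) + 12 ≤⟨ large ⟩
    count S? ≤⟨ count-avoid S? (a true) ⟩
    count near? + sum (λ l → 𝟙 (S? (a true l)))
      ≤⟨ +-mono-≤ (count-avoid near? (a false)) (sum-≤-const 1 (λ l → 𝟙≤1 (S? (a true l)))) ⟩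
    count (λ x → near? x ×-dec ¬? (∈image? (a false) x)) + sum (λ l → 𝟙 (near? (a false l))) + 3
      ≤⟨ +-monoˡ-≤ 3 (+-mono-≤ (count-mono (λ x → near? x ×-dec ¬? (∈image? (a false) x)) S⁻?
           (λ ((s , ¬t) , ¬f) → s , λ { (true , q) → ¬t q ; (false , q) → ¬f q }))
           (sum-≤-const 1 (λ l → 𝟙≤1 (near? (a false l))))) ⟩
    count S⁻? + 3 + 3 ≡⟨ +-assoc (count S⁻?) 3 3 ⟩
    count S⁻? + 6 ∎)
    where
    open ≤-Reasoning
    near? = λ x → S? x ×-dec ¬? (∈image? (a true) x)
    arrange : ∀ k → 6 * (1 + k) + 12 + 6 ≡ 6 * (2 + k) + 12
    arrange = solve 1 (λ k → con 6 :* (con 1 :+ k) :+ con 12 :+ con 6 := con 6 :* (con 2 :+ k) :+ con 12) refl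
      where open +-*-Solver

  module Lift (R : Realization S⁻ e₂) where
    module R = Realization R

    -- The two uses of the edge from y to `a f j` cannot collide: a spoke requires j to be a port of
    -- y, a hand-over requires it to be the slot.
    Hop : Bool → Fin 3 → Fin n → Fin m → Set
    Hop f j y i = (Spoke f y j i × ¬ Foreign f y) ⊎ ∃[ b ] (Need f j b i × φ f j i b ≡ y)

    Step : Fin n → Fin n → Fin m → Set
    Step x y i = ∃[ f ] ∃[ j ] (x ≡ a f j × Hop f j y i)

    Own : Fin n → Fin n → Fin m → Set
    Own x y i = R.Own x y i ⊎ (Step x y i ⊎ Step y x i)

    own-sym : ∀ {x y i} → Own x y i → Own y x i
    own-sym (inj₁ o)        = inj₁ (R.own-sym o)
    own-sym (inj₂ (inj₁ s)) = inj₂ (inj₂ s)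
    own-sym (inj₂ (inj₂ s)) = inj₂ (inj₁ s)

    hop-S : ∀ {f j y i} → Hop f j y i → S y
    hop-S {f} (inj₁ (sp , _))        = Centre.spoke-S f sp
    hop-S     (inj₂ (_ , need , refl)) = proj₁ (proj₁ (φ-target need))

    hop-≢ : ∀ {f j y i} → Hop f j y i → y ≢ a f j
    hop-≢ (inj₁ ((_ , y≢a , _) , _)) q = y≢a q
    hop-≢ (inj₂ (_ , need , refl))   q = proj₂ (proj₁ (φ-target need)) (_ , _ , q)

    hop-unique : ∀ {f j y i i′} → Hop f j y i → Hop f j y i′ → i ≡ i′
    hop-unique {f} (inj₁ (sp , _)) (inj₁ (sp′ , _)) = Centre.spoke-unique f sp sp′
    hop-unique {f} (inj₁ (sp , _)) (inj₂ (_ , need , refl)) = contradiction (sym (proj₂ (φ-target need))) (Centre.spoke-slot f sp)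
    hop-unique {f} (inj₂ (_ , need , refl)) (inj₁ (sp , _)) = contradiction (sym (proj₂ (φ-target need))) (Centre.spoke-slot f sp)
    hop-unique (inj₂ (_ , need , q)) (inj₂ (_ , need′ , q′)) = proj₁ (φ-injective need need′ (trans q (sym q′)))

    step-unique : ∀ {x y i i′} → Step x y i → Step x y i′ → i ≡ i′
    step-unique (f , j , q , h) (f′ , j′ , q′ , h′) with a-injective (trans (sym q) q′)
    ... | refl , refl = hop-unique h h′

    -- Foreign halves do not move and targets are never centres, so no edge between centres of
    -- different factors is used. Only edges within a factor remain, and `spoke-cross` handles them.
    hop-centre : ∀ {f j g l i} → Hop f j (a g l) i → f ≡ g × Spoke f (a g l) j i
    hop-centre (inj₂ (_ , need , q)) = contradiction (_ , _ , q) (proj₂ (proj₁ (φ-target need)))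
    hop-centre {f} {g = g} {l} (inj₁ (sp , ¬foreign)) with f Bool.≟ g
    ... | yes q  = q , sp
    ... | no f≢g = contradiction (l , cong (λ h → a h l) (sym (not-≢ f≢g))) ¬foreign

    step-antisym : ∀ {x y i i′} → Step x y i → ¬ Step y x i′
    step-antisym (f , j , refl , h) (g , l , refl , h′) with hop-centre h | hop-centre h′
    ... | refl , sp | _ , sp′ = Centre.spoke-cross f sp sp′

    step-centre : ∀ {x y i} → Step x y i → Centre∋ x
    step-centre (f , j , q , _) = f , j , q

    not-lower : ∀ {x y i i′} → R.Own x y i → ¬ (Step x y i′ ⊎ Step y x i′)
    not-lower o (inj₁ s) = proj₂ (R.own-S o) (step-centre s)
    not-lower o (inj₂ s) = proj₂ (R.own-S (R.own-sym o)) (step-centre s)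

    own-unique : ∀ {x y i i′} → Own x y i → Own x y i′ → i ≡ i′
    own-unique (inj₁ o) (inj₁ o′) = R.own-unique o o′
    own-unique (inj₁ o) (inj₂ s)  = contradiction s (not-lower o)
    own-unique (inj₂ s) (inj₁ o)  = contradiction s (not-lower o)
    own-unique (inj₂ (inj₁ s)) (inj₂ (inj₁ s′)) = step-unique s s′
    own-unique (inj₂ (inj₁ s)) (inj₂ (inj₂ s′)) = contradiction s′ (step-antisym s)
    own-unique (inj₂ (inj₂ s)) (inj₂ (inj₁ s′)) = contradiction s (step-antisym s′)
    own-unique (inj₂ (inj₂ s)) (inj₂ (inj₂ s′)) = step-unique s s′

    Route : Fin m → Fin n → Fin n → Set
    Route i = Star (λ x y → Own x y i)

    move : ∀ i b → Route i (e i b) (e₁ i b)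
    move i b with class-cases i
    ... | inj₂ c       = subst (Route i (e i b)) (sym (e₁-rest b c)) ε
    ... | inj₁ (f , c) = go (foreign? f (e i b)) (e i b ≟ a f (port f b (e i b)))
      where
      go : Dec (Foreign f (e i b)) → Dec (e i b ≡ a f (port f b (e i b))) → Route i (e i b) (e₁ i b)
      go (yes q) _       = subst (Route i (e i b)) (sym (e₁-foreign b c q)) ε
      go (no ¬q) (yes r) = subst (Route i (e i b)) (sym (trans (e₁-own b c ¬q) (sym r))) ε
      go (no ¬q) (no ¬r) = subst (Route i (e i b)) (sym (e₁-own b c ¬q))
                             (return (inj₂ (inj₂ (f , _ , refl , inj₁ ((c , ¬r , b , refl , refl) , ¬q)))))

    hand-over : ∀ i b → Route i (e₁ i b) (e₂ i b)
    hand-over i b with retargeted i b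
    ... | stayed _ q       = subst (Route i (e₁ i b)) (sym q) ε
    ... | moved f j need q = return (inj₂ (inj₁ (f , j , proj₂ need , inj₂ (b , need , sym q))))

    realization : Realization S e
    realization = record
      { Own = Own
      ; own-sym = own-sym
      ; own-irrefl = λ { (inj₁ o) → R.own-irrefl o
                       ; (inj₂ (inj₁ (_ , _ , refl , h))) q → hop-≢ h (sym q)
                       ; (inj₂ (inj₂ (_ , _ , refl , h))) q → hop-≢ h q }
      ; own-S = λ { (inj₁ o) → proj₁ (R.own-S o)
                  ; (inj₂ (inj₁ (f , j , refl , _))) → a-S f j
                  ; (inj₂ (inj₂ (_ , _ , _ , h))) → hop-S h }
      ; own-unique = own-unique
      ; connected = λ i → move i true ◅◅ hand-over i true ◅◅ Star-map inj₁ (R.connected i)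
                            ◅◅ reverse own-sym (hand-over i false) ◅◅ reverse own-sym (move i false)
      }

-- The choice of the centres

module _ {n m} {S : Pred (Fin n) 0ℓ} {S? : Decidable S} {F : Pred (Fin m) 0ℓ} {e : Fin m → Bool → Fin n}
         (P : Ports S? F e) (large : 18 ≤ count S?) where
  open Ports P

  -- Each colour is missing at no fewer than 18/3 - 2 = 4 vertices, one more than have to be
  -- avoided. Centres of different colours need no separate care, as their slots differ.
  centred : ∀ {k} (avoid : Fin k → Fin n) → k ≤ 3 → Σ (Centred P) λ C → ∀ j l → Centred.centre C j ≢ avoid l
  centred {k} avoid k≤3 = record { centre = λ j → proj₁ (find j) ; centre-S = λ j → proj₁ (proj₁ (proj₂ (find j)))
                                 ; centre-slot = λ j → proj₂ (proj₁ (proj₂ (find j))) }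
                        , λ j l q → proj₂ (proj₂ (find j)) (l , q)
    where
    slot? : ∀ j → Decidable (λ x → S x × succ₃ j ≡ slot x)
    slot? j x = S? x ×-dec (succ₃ j ≟ slot x)
    many : ∀ j → 4 ≤ count (slot? j)
    many j = +-cancelʳ-≤ 2 4 (count (slot? j)) (*-cancelˡ-≤ 3 (≤-trans large (balanced (succ₃ j))))
    find : ∀ j → ∃[ x ] ((S x × succ₃ j ≡ slot x) × ¬ (∃[ l ] x ≡ avoid l))
    find j = count-witness (λ x → slot? j x ×-dec ¬? (∈image? avoid x)) (+-cancelʳ-≤ 3 1 _ (begin
      4 ≤⟨ many j ⟩
      count (slot? j) ≤⟨ count-avoid (slot? j) avoid ⟩
      count (λ x → slot? j x ×-dec ¬? (∈image? avoid x)) + sum (λ l → 𝟙 (slot? j (avoid l)))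
        ≤⟨ +-monoʳ-≤ _ (≤-trans (sum-≤-const 1 (λ l → 𝟙≤1 (slot? j (avoid l)))) (≤-trans (≤-reflexive (*-identityʳ k)) k≤3)) ⟩
      count (λ x → slot? j x ×-dec ¬? (∈image? avoid x)) + 3 ∎))
      where open ≤-Reasoning

-- Orienting the demands, and the induction

module _ {m n} (e : Fin m → Bool → Fin n) (o : Fin m → Bool) where

  oriented : Fin m → Bool → Fin n
  oriented i true  = e i (o i)
  oriented i false = e i (not (o i))

  oriented-active : ∀ {i} → Active oriented i → Active e i
  oriented-active {i} act with o i
  ... | true  = act
  ... | false = act ∘ sym

  oriented-ends : ∀ {Q : Pred (Fin n) 0ℓ} {i} → (∀ b → Q (e i b)) → ∀ b → Q (oriented i b)
  oriented-ends {i = i} q true  = q (o i)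
  oriented-ends {i = i} q false = q (not (o i))

  unorient : ∀ {S} → Realization S oriented → Realization S e
  unorient R = record { Own = Own ; own-sym = own-sym ; own-irrefl = own-irrefl ; own-S = own-S ; own-unique = own-unique
                      ; connected = λ i → flip i (o i) refl }
    where
    open Realization R
    flip : ∀ i b → o i ≡ b → Star (λ x y → Own x y i) (e i true) (e i false)
    flip i true  q = subst (λ b → Star (λ x y → Own x y i) (e i b) (e i (not b))) q (connected i)
    flip i false q = reverse own-sym (subst (λ b → Star (λ x y → Own x y i) (e i b) (e i (not b))) q (connected i))

  open Orientation (_≟_ {n}) using (ends; atEnd?; Balanced)

  ends-total : ∀ x → ends (active? e) e o x + ends (active? e) e (not ∘ o) x ≡ incidence e true x + incidence e false x
  ends-total x = begin
    ends (active? e) e o x + ends (active? e) e (not ∘ o) x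
      ≡⟨ ∑-distrib-+ (λ i → 𝟙 (at? (active? e) e (o i) x i)) (λ i → 𝟙 (at? (active? e) e (not (o i)) x i)) ⟨
    sum (λ i → 𝟙 (at? (active? e) e (o i) x i) + 𝟙 (at? (active? e) e (not (o i)) x i))
      ≡⟨ sum-cong-≗ (λ i → either i (o i)) ⟩
    sum (λ i → 𝟙 (at? (active? e) e true x i) + 𝟙 (at? (active? e) e false x i))
      ≡⟨ ∑-distrib-+ (λ i → 𝟙 (at? (active? e) e true x i)) (λ i → 𝟙 (at? (active? e) e false x i)) ⟩
    incidence e true x + incidence e false x ∎
    where
    open ≡-Reasoning
    either : ∀ i b → 𝟙 (at? (active? e) e b x i) + 𝟙 (at? (active? e) e (not b) x i)
                   ≡ 𝟙 (at? (active? e) e true x i) + 𝟙 (at? (active? e) e false x i)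
    either i true  = refl
    either i false = +-comm (𝟙 (at? (active? e) e false x i)) _

  -- Parity: 2x is at most x + y + 1, hence at most 2k + 1.
  larger-half : ∀ {x y} k → x ≤ suc y → x + y ≤ 2 * k → x ≤ k
  larger-half {x} {y} k x≤ x+y≤ = ≮⇒≥ λ k<x → <⇒≱ (≤-trans (s≤s (≤-reflexive (cong (k +_) (+-identityʳ k))))
    (+-mono-≤ k<x (s≤s⁻¹ (≤-trans k<x x≤)))) x+y≤

  oriented-incidence : ∀ k → Balanced (active? e) e o → (∀ x → incidence e true x + incidence e false x ≤ 2 * k) →
                       ∀ b x → count (at? (active? oriented) oriented b x) ≤ k
  oriented-incidence k bal deg true x = ≤-trans
    (count-mono (at? (active? oriented) oriented true x) (atEnd? (active? e) e o x) (λ (act , q) → oriented-active act , q))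
    (larger-half k (proj₁ (bal x)) (≤-trans (≤-reflexive (ends-total x)) (deg x)))
  oriented-incidence k bal deg false x = ≤-trans
    (count-mono (at? (active? oriented) oriented false x) (atEnd? (active? e) e (not ∘ o) x) (λ (act , q) → oriented-active act , q))
    (larger-half k (proj₂ (bal x)) (≤-trans (≤-reflexive (trans (+-comm (ends (active? e) e (not ∘ o) x) _) (ends-total x))) (deg x)))

-- Two factors take up to four from the degree of a vertex and hand-overs return at most two, so k
-- drops by one. As the step consumes two factors, k = 1 is settled by routing one factor directly;
-- for k = 0 every demand is a loop.
realizable : ∀ {m n} k {S : Pred (Fin n) 0ℓ} (S? : Decidable S) (e : Fin m → Bool → Fin n) →
             (∀ {i} b → Active e i → S (e i b)) → (∀ x → incidence e true x + incidence e false x ≤ 2 * k) →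
             6 * k + 12 ≤ count S? → Realization S e
realizable {m} {n} zero S? e S-ends deg large = record
  { Own = λ _ _ _ → ⊥ ; own-sym = λ () ; own-irrefl = λ () ; own-S = λ () ; own-unique = λ ()
  ; connected = λ i → connect i (e i true ≟ e i false) }
  where
  connect : ∀ i → Dec (e i true ≡ e i false) → Star (λ _ _ → ⊥) (e i true) (e i false)
  connect i (yes q) = subst (Star _ (e i true)) q ε
  connect i (no ¬q) = contradiction (≤-trans (count-pos (at? (active? e) e true (e i true)) {i} (¬q , refl)) (≤-trans (m≤m+n _ _) (deg (e i true)))) λ ()
realizable {m} {n} (suc k) {S} S? e S-ends deg large = orient (Orientation.balanced-orientation _≟_ (active? e) e)
  where
  18≤ : 18 ≤ count S?
  18≤ = ≤-trans (+-monoˡ-≤ 12 (*-monoʳ-≤ 6 (s≤s (z≤n {k})))) large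

  one-or-two : ∀ k (d : Fin m → Bool → Fin n) → (∀ {i} b → Active d i → S (d i b)) →
               (∀ b x → count (at? (active? d) d b x) ≤ suc k) → 6 * suc k + 12 ≤ count S? →
               (∀ {S′ : Pred (Fin n) 0ℓ} (S′? : Decidable S′) (d′ : Fin m → Bool → Fin n) →
                 (∀ {i} b → Active d′ i → S′ (d′ i b)) → (∀ x → incidence d′ true x + incidence d′ false x ≤ 2 * k) →
                 6 * k + 12 ≤ count S′? → Realization S′ d′) →
               Realization S d
  one-or-two zero d S-ends deg large rec = OneFactor.realization S-ends proper P centre centre-S centre-slot
    where
    proper : ∀ {i j} b → Active d i → Active d j → d i b ≡ d j b → i ≡ j
    proper {i} {j} b a a′ q = count≤1⇒unique (at? (active? d) d b (d j b)) (deg b (d j b)) (a , q) (a′ , refl)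
    P : Ports S? (Active d) d
    P = ports S? d S-ends id (chains S? (active? d) d S-ends proper)
    open Centred (proj₁ (centred P 18≤ {0} (λ ()) z≤n))
  one-or-two (suc k) d S-ends deg large rec = Lift.realization (rec S⁻? e₂ e₂-S⁻ e₂-degree S⁻-large)
    where
    two : TwoFactors (active? d) d k
    two = two-factors (active? d) d deg
    open TwoFactors two
    P : ∀ f → Ports S? (λ i → class i ≡ just f) d
    P f = ports S? d (λ b c → S-ends b (class-active c)) class-active
            (chains S? (λ i → class i ≟ᴹ just f) d (λ b c → S-ends b (class-active c)) class-proper)
    C₁ = proj₁ (centred (P true) 18≤ {0} (λ ()) z≤n)
    C₂ = centred (P false) 18≤ (Centred.centre C₁) ≤-refl
    C : ∀ f → Centred (P f)
    C true  = C₁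
    C false = proj₁ C₂
    open TwoFactorStep S? d S-ends two P C (λ j l q → proj₂ C₂ l j (sym q)) large

  orient : Σ (Fin m → Bool) (Orientation.Balanced _≟_ (active? e) e) → Realization S e
  orient (o , bal) = unorient e o (one-or-two k (oriented e o)
    (λ {i} b act → oriented-ends e o {Q = S} (λ b → S-ends b (oriented-active e o act)) b)
    (oriented-incidence e o (suc k) bal deg) large (realizable k))

-- From realizations to edge-disjoint paths

module _ {n : ℕ} where

  suffix : ∀ {u v w : Fin n} (p : Walk u v) → IsPath p → w ∈ vertices p →
           Σ (Path w v) λ q → ∀ {a b} → UsesEdge a b (proj₁ q) → UsesEdge a b p
  suffix [ u ]         P       (here refl) = ([ u ] , P) , id
  suffix (u ∷⟨ ne ⟩ p) P       (here refl) = ((u ∷⟨ ne ⟩ p) , P) , id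
  suffix (u ∷⟨ ne ⟩ p) (_ ∷ P) (there w∈p) = let (q , q⊆p) = suffix p P w∈p in q , there ∘ q⊆p

  -- If the new vertex already lies on the path, the path is cut back to its suffix from there. This
  -- only discards edges, so all used edges keep their owner.
  shorten : {R : Fin n → Fin n → Set} → (∀ {x y} → R x y → R y x) → (∀ {x y} → R x y → x ≢ y) → ∀ {u v} → Star R u v →
            Σ (Path u v) λ p → ∀ {a b} → UsesEdge a b (proj₁ p) → R a b
  shorten R-sym R-irrefl {u} ε = ([ u ] , [] ∷ []) , λ ()
  shorten {R} R-sym R-irrefl {u} {v} (_◅_ {j = w} r rs) = extend (shorten R-sym R-irrefl rs)
    where
    open DecMembership (_≟_ {n}) using (_∈?_)
    extend : (Σ (Path w v) λ p → ∀ {a b} → UsesEdge a b (proj₁ p) → R a b) → Σ (Path u v) λ p → ∀ {a b} → UsesEdge a b (proj₁ p) → R a b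
    extend ((p , P) , p⊆R) with u ∈? vertices p
    ... | yes u∈p = let (q , q⊆p) = suffix p P u∈p in q , p⊆R ∘ q⊆p
    ... | no  u∉p = ((u ∷⟨ R-irrefl r ⟩ p) , (¬Any⇒All¬ (vertices p) u∉p ∷ P))
                  , λ { (here refl) → r ; (here' refl) → R-sym r ; (there uses) → p⊆R uses }

length-filter : ∀ {A : Set} {P : A → Set} (P? : Decidable P) (xs : List A) →
                count (λ i → P? (lookup xs i)) ≡ length (filter P? xs)
length-filter P? []       = refl
length-filter P? (x ∷ xs) with P? x
... | yes _ = cong suc (length-filter P? xs)
... | no _  = length-filter P? xs

module _ {n} (D : DemandGraph n) where

  demand : Fin (length D) → Bool → Fin n
  demand i true  = proj₁ (lookup D i)
  demand i false = proj₂ (lookup D i)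

  demand-degree : ∀ x → incidence demand true x + incidence demand false x ≤ degree D x
  demand-degree x = begin
    incidence demand true x + incidence demand false x
      ≡⟨ ∑-distrib-+ (λ i → 𝟙 (at? (active? demand) demand true x i)) (λ i → 𝟙 (at? (active? demand) demand false x i)) ⟨
    sum (λ i → 𝟙 (at? (active? demand) demand true x i) + 𝟙 (at? (active? demand) demand false x i))
      ≤⟨ sum-mono (λ i → one-end (demand i true ≟ x) (demand i false ≟ x) (active? demand i) λ p q act → act (trans p (sym q))) ⟩
    count (λ i → (proj₁ (lookup D i) ≟ x) ⊎-dec (proj₂ (lookup D i) ≟ x))
      ≡⟨ length-filter (λ d → (proj₁ d ≟ x) ⊎-dec (proj₂ d ≟ x)) D ⟩
    degree D x ∎
    where
    open ≤-Reasoning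
    one-end : {A X Y : Set} (x? : Dec X) (y? : Dec Y) (a? : Dec A) → (X → Y → ¬ A) →
              𝟙 (a? ×-dec x?) + 𝟙 (a? ×-dec y?) ≤ 𝟙 (x? ⊎-dec y?)
    one-end x?      y?      (no _)  _  = z≤n
    one-end (yes x) (yes y) (yes a) xy = contradiction a (xy x y)
    one-end (yes _) (no _)  (yes _) _  = ≤-refl
    one-end (no _)  (yes _) (yes _) _  = ≤-refl
    one-end (no _)  (no _)  (yes _) _  = z≤n

  realization⇒paths : ∀ {S} → Realization S demand → RealizableInComplete D
  realization⇒paths R = (λ i → proj₁ (path i)) , λ i j i≢j a b uses uses′ → i≢j (own-unique (proj₂ (path i) uses) (proj₂ (path j) uses′))
    where
    open Realization R
    path : ∀ i → Σ (Path (proj₁ (lookup D i)) (proj₂ (lookup D i))) λ p → ∀ {a b} → UsesEdge a b (proj₁ p) → Own a b i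
    path i = shorten own-sym own-irrefl (connected i)

-- The arithmetic of the degree bound

mainTheorem10 : (n : ℕ) → (D : DemandGraph (suc n)) → Loopless D →
    (∀ v → degree D v + 4 Data.Nat.≤ 2 * (suc n / 6)) →
    RealizableInComplete D
mainTheorem10 n D _ deg = go (suc n / 6) (m/n*n≤m (suc n) 6) deg
  where
  go : ∀ q → q * 6 ≤ suc n → (∀ v → degree D v + 4 ≤ 2 * q) → RealizableInComplete D
  -- For q below 2 the degree hypothesis already fails at vertex `zero`, since 2q < 4.
  go 0 _ deg = contradiction (≤-trans (m≤n+m 4 _) (deg zero)) λ ()
  go 1 _ deg = contradiction (≤-trans (m≤n+m 4 _) (deg zero)) λ { (s≤s (s≤s ())) }
  -- With q = k + 2 the degree bound 2q - 4 is 2k, and the 6q vertices available are the 6k + 12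
  -- that the induction requires.
  go (suc (suc k)) 6q≤n deg = realization⇒paths D (realizable k {λ _ → ⊤} (λ _ → yes tt) (demand D) (λ _ _ → tt)
    (λ x → ≤-trans (demand-degree D x) (+-cancelʳ-≤ 4 _ _ (≤-trans (deg x) (≤-reflexive (double k)))))
    (≤-trans (≤-trans (≤-reflexive (six k)) 6q≤n) (n≤sum (λ _ → ≤-refl))))
    where
    open +-*-Solver
    double : ∀ k → 2 * (2 + k) ≡ 2 * k + 4
    double = solve 1 (λ k → con 2 :* (con 2 :+ k) := con 2 :* k :+ con 4) refl
    six : ∀ k → 6 * k + 12 ≡ (2 + k) * 6
    six = solve 1 (λ k → con 6 :* k :+ con 12 := (con 2 :+ k) :* con 6) refl
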